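{- For $u,v,n \in \mathbb{N}$, let $D(u,v,n)$ denote the number of admissible coloured partitions (as defined in the context) whose size is $n$ and whose weights are $u$ and $v$. Then, as formal power series in $a,b,q$, \begin{equation*} \sum_{u,v,n \in \mathbb{N}} D(u,v,n)\,a^u b^v q^n = \prod_{n\geq 1} \left(1+aq^n\right)\left(1+bq^n\right). \end{equation*}
   Context: Coloured integers: every positive integer $k$ occurs in the three colours $a$, $b$, $ab$ (written $k_a$, $k_b$, $k_{ab}$). In addition, odd positive integers occur in the colours $a^2$ and $b^2$: $k_{b^2}$ for every odd $k\ge 1$ and $k_{a^2}$ for every odd $k \geq 3$. The integer value of $k_x$ is $k$ and its colour is $x$. These coloured integers are totally ordered by $$1_{ab} < 1_a < 1_{b^2} <1_{b} <2_{ab} < 2_a <3_{a^2} < 2_{b} <3_{ab} < 3_a < 3_{b^2} <3_b <4_{ab}<4_a<5_{a^2}<4_b<5_{ab}<\cdots,$$ that is, for every odd $m\ge1$: $m_{ab}<m_a<m_{b^2}<m_b<(m+1)_{ab}<(m+1)_a<(m+2)_{a^2}<(m+1)_b<(m+2)_{ab}$. Difference conditions: for a coloured integer $\lambda$ (the "upper" part) of colour $x$ and a coloured integer $\mu$ (the "lower" part) of colour $y$, a minimal difference $A(\lambda,\mu)$ is defined as follows, where the row is determined by the colour and the parity of the integer value of $\lambda$, and the entries are listed for $y = a, b, ab, a^2, b^2$ in this order: - $\lambda$ of colour $a$, odd: $2,2,1,2,2$; - $\lambda$ of colour $b^2$: $2,3,2,2,4$; - $\lambda$ of colour $b$, odd: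 $1,2,1,2,2$; - $\lambda$ of colour $ab$, even: $2,2,2,3,3$; - $\lambda$ of colour $a$, even: $2,2,2,3,3$; - $\lambda$ of colour $a^2$: $3,3,3,4,4$; - $\lambda$ of colour $b$, even: $1,2,1,1,3$; - $\lambda$ of colour $ab$, odd: $2,3,2,2,3$. An admissible coloured partition is a finite (possibly empty) sequence $\lambda_1,\dots,\lambda_s$ of coloured integers, none of which equals $1_{ab}$ or $1_{b^2}$, such that for every $1\le i<s$ the integer values satisfy $\lambda_i-\lambda_{i+1}\ge A(\lambda_i,\lambda_{i+1})$. Its size is the sum of the integer values of its parts. Its weight $u$ is the number of parts of colour $a$ or $ab$ plus twice the number of parts of colour $a^2$; its weight $v$ is the number of parts of colour $b$ or $ab$ plus twice the number of parts of colour $b^2$. -}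

module Defs where

open import Data.List.Base
  using (List; []; _∷_; length; map; filter; upTo; cartesianProductWith; concatMap; deduplicate)
import Data.List.Properties as List
open import Data.List.Membership.Propositional using (_∈_)
open import Data.List.Membership.Propositional.Properties
  using (∈-filter⁺; ∈-filter⁻; ∈-deduplicate⁺; ∈-deduplicate⁻; ∈-cartesianProductWith⁺; ∈-concatMap⁺; ∈-upTo⁺)
open import Data.List.Relation.Unary.All using (All; []; _∷_; all?)
import Data.List.Relation.Unary.All as All
open import Data.List.Relation.Unary.Any using (here; there)
import Data.List.Relation.Unary.Any as Any
open import Data.List.Relation.Unary.Linked using (Linked; linked?)
open import Data.List.Relation.Unary.Unique.Propositional using (Unique)
import Data.List.Relation.Unary.Unique.DecPropositional.Properties as Unique
open import Data.Nat.Base using (ℕ; zero; suc; _+_; _*_; _∸_; _≤_; _≥_; z≤n; s≤s; parity)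
open import Data.Nat.ListAction using (sum)
open import Data.Nat.Properties as ℕ
  using (_≤?_; ≤-trans; m≤m+n; m≤n+m; +-mono-≤)
open import Data.Parity.Base using (Parity; 0ℙ; 1ℙ)
import Data.Parity.Properties as ℙ
open import Data.Product.Base using (_×_; _,_; proj₂; ∃-syntax)
open import Function.Base using (_∘_)
open import Function.Bundles using (_⇔_; mk⇔)
open import Relation.Binary.Definitions using (DecidableEquality)
open import Relation.Binary.PropositionalEquality using (_≡_; _≢_; refl)
open import Relation.Nullary using (Dec; yes; no; ¬?; _×-dec_; recompute)
open import Relation.Nullary.Decidable using (map′)

data Colour : Set where
  a b ab a² b² : Colour

Occurs : ℕ → Colour → Set
Occurs k a  = 1 ≤ k
Occurs k b  = 1 ≤ k
Occurs k ab = 1 ≤ k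
Occurs k a² = parity k ≡ 1ℙ × 3 ≤ k
Occurs k b² = parity k ≡ 1ℙ × 1 ≤ k

-- The proof is irrelevant, so that coloured integers with the same value
-- and colour are equal.
record ColouredInteger : Set where
  constructor coloured
  field
    value   : ℕ
    colour  : Colour
    .occurs : Occurs value colour

open ColouredInteger public using (value; colour)

1-ab 1-b² : ColouredInteger
1-ab = coloured 1 ab (s≤s z≤n)
1-b² = coloured 1 b² (refl , s≤s z≤n)

row : (entry-a entry-b entry-ab entry-a² entry-b² : ℕ) → Colour → ℕ
row p q r s t a  = p
row p q r s t b  = q
row p q r s t ab = r
row p q r s t a² = s
row p q r s t b² = t

-- Colour and parity of the upper part, then colour of the lower part.  Parts
-- of colour a² or b² are always odd, so the parity is ignored in their rows.
minimalDifference : Colour → Parity → Colour → ℕ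
minimalDifference a  1ℙ = row 2 2 1 2 2
minimalDifference b² _  = row 2 3 2 2 4
minimalDifference b  1ℙ = row 1 2 1 2 2
minimalDifference ab 0ℙ = row 2 2 2 3 3
minimalDifference a  0ℙ = row 2 2 2 3 3
minimalDifference a² _  = row 3 3 3 4 4
minimalDifference b  0ℙ = row 1 2 1 1 3
minimalDifference ab 1ℙ = row 2 3 2 2 3

A : ColouredInteger → ColouredInteger → ℕ
A x y = minimalDifference (colour x) (parity (value x)) (colour y)

-- value x - value y ≥ A x y, without truncated subtraction.
_▷_ : ColouredInteger → ColouredInteger → Set
x ▷ y = A x y + value y ≤ value x

-- λ₁ , … , λₛ is listed from λ₁ on; Linked relates consecutive entries.
Admissible : List ColouredInteger → Set
Admissible xs = All (λ x → x ≢ 1-ab × x ≢ 1-b²) xs × Linked _▷_ xs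

size : List ColouredInteger → ℕ
size xs = sum (map value xs)

a-exponent b-exponent : Colour → ℕ
a-exponent a  = 1
a-exponent b  = 0
a-exponent ab = 1
a-exponent a² = 2
a-exponent b² = 0
b-exponent a  = 0
b-exponent b  = 1
b-exponent ab = 1
b-exponent a² = 0
b-exponent b² = 2

u-weight v-weight : List ColouredInteger → ℕ
u-weight xs = sum (map (a-exponent ∘ colour) xs)
v-weight xs = sum (map (b-exponent ∘ colour) xs)

IsCounted : ℕ → ℕ → ℕ → List ColouredInteger → Set
IsCounted u v n xs =
  Admissible xs × u-weight xs ≡ u × v-weight xs ≡ v × size xs ≡ n

_≟ᶜ_ : DecidableEquality Colour
a  ≟ᶜ a  = yes refl
a  ≟ᶜ b  = no λ ()
a  ≟ᶜ ab = no λ ()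
a  ≟ᶜ a² = no λ ()
a  ≟ᶜ b² = no λ ()
b  ≟ᶜ a  = no λ ()
b  ≟ᶜ b  = yes refl
b  ≟ᶜ ab = no λ ()
b  ≟ᶜ a² = no λ ()
b  ≟ᶜ b² = no λ ()
ab ≟ᶜ a  = no λ ()
ab ≟ᶜ b  = no λ ()
ab ≟ᶜ ab = yes refl
ab ≟ᶜ a² = no λ ()
ab ≟ᶜ b² = no λ ()
a² ≟ᶜ a  = no λ ()
a² ≟ᶜ b  = no λ ()
a² ≟ᶜ ab = no λ ()
a² ≟ᶜ a² = yes refl
a² ≟ᶜ b² = no λ ()
b² ≟ᶜ a  = no λ ()
b² ≟ᶜ b  = no λ ()
b² ≟ᶜ ab = no λ ()
b² ≟ᶜ a² = no λ ()
b² ≟ᶜ b² = yes refl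

_≟_ : DecidableEquality ColouredInteger
coloured k c _ ≟ coloured l d _ =
  map′ (λ { (refl , refl) → refl }) (λ { refl → refl , refl }) ((k ℕ.≟ l) ×-dec (c ≟ᶜ d))

_≟ᴸ_ : DecidableEquality (List ColouredInteger)
_≟ᴸ_ = List.≡-dec _≟_

occurs? : ∀ k c → Dec (Occurs k c)
occurs? k a  = 1 ≤? k
occurs? k b  = 1 ≤? k
occurs? k ab = 1 ≤? k
occurs? k a² = (parity k ℙ.≟ 1ℙ) ×-dec (3 ≤? k)
occurs? k b² = (parity k ℙ.≟ 1ℙ) ×-dec (1 ≤? k)

admissible? : ∀ xs → Dec (Admissible xs)
admissible? xs =
  all? (λ x → ¬? (x ≟ 1-ab) ×-dec ¬? (x ≟ 1-b²)) xs
    ×-dec linked? (λ x y → A x y + value y ≤? value x) xs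

isCounted? : ∀ u v n xs → Dec (IsCounted u v n xs)
isCounted? u v n xs =
  admissible? xs ×-dec (u-weight xs ℕ.≟ u) ×-dec (v-weight xs ℕ.≟ v) ×-dec (size xs ℕ.≟ n)

withColour : ℕ → Colour → List ColouredInteger
withColour k c with occurs? k c
... | yes o = coloured k c o ∷ []
... | no _  = []

partsOfValue : ℕ → List ColouredInteger
partsOfValue k = concatMap (withColour k) (a ∷ b ∷ ab ∷ a² ∷ b² ∷ [])

partsUpTo : ℕ → List ColouredInteger
partsUpTo n = concatMap partsOfValue (upTo (suc n))

sequences : ℕ → List ColouredInteger → List (List ColouredInteger)
sequences zero    ps = [] ∷ []
sequences (suc l) ps = [] ∷ cartesianProductWith _∷_ ps (sequences l ps)

-- A sequence of size n has at most n parts, each of value at most n.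
partitions : ℕ → ℕ → ℕ → List (List ColouredInteger)
partitions u v n =
  deduplicate _≟ᴸ_ (filter (isCounted? u v n) (sequences n (partsUpTo n)))

D : ℕ → ℕ → ℕ → ℕ
D u v n = length (partitions u v n)

-- D u v n is the number of admissible coloured partitions with weights u and
-- v and size n: the list it measures has no repetitions and contains exactly
-- these partitions (partitions-unique, ∈-partitions⇔).

partitions-unique : ∀ u v n → Unique (partitions u v n)
partitions-unique u v n =
  Unique.deduplicate-! _≟ᴸ_ (filter (isCounted? u v n) (sequences n (partsUpTo n)))

private
  value≥1 : ∀ x → 1 ≤ value x
  value≥1 (coloured k c o) = positive c (recompute (occurs? k c) o)
    where
    positive : ∀ c → Occurs k c → 1 ≤ k
    positive a  p       = p
    positive b  p       = p
    positive ab p       = p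
    positive a² (_ , p) = ≤-trans (s≤s z≤n) p
    positive b² (_ , p) = p

  ∈-colours : ∀ c → c ∈ a ∷ b ∷ ab ∷ a² ∷ b² ∷ []
  ∈-colours a  = here refl
  ∈-colours b  = there (here refl)
  ∈-colours ab = there (there (here refl))
  ∈-colours a² = there (there (there (here refl)))
  ∈-colours b² = there (there (there (there (here refl))))

  ∈-withColour : ∀ x → x ∈ withColour (value x) (colour x)
  ∈-withColour (coloured k c o) with occurs? k c
  ... | yes _ = here refl
  ... | no ¬o with () ← ¬o (recompute (occurs? k c) o)

  ∈-concatMap : ∀ {X Y : Set} (f : X → List Y) {x y xs} → x ∈ xs → y ∈ f x → y ∈ concatMap f xs
  ∈-concatMap f x∈xs y∈fx = ∈-concatMap⁺ f (Any.map (λ { refl → y∈fx }) x∈xs)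

  ∈-partsUpTo : ∀ {n} x → value x ≤ n → x ∈ partsUpTo n
  ∈-partsUpTo x x≤n =
    ∈-concatMap partsOfValue (∈-upTo⁺ (s≤s x≤n))
      (∈-concatMap (withColour (value x)) (∈-colours (colour x)) (∈-withColour x))

  ∈-sequences : ∀ {l ps} xs → length xs ≤ l → All (_∈ ps) xs → xs ∈ sequences l ps
  ∈-sequences {zero}  []       _       _        = here refl
  ∈-sequences {suc l} []       _       _        = here refl
  ∈-sequences {suc l} (x ∷ xs) (s≤s p) (q ∷ qs) =
    there (∈-cartesianProductWith⁺ _∷_ q (∈-sequences xs p qs))

  length≤size : ∀ xs → length xs ≤ size xs
  length≤size []       = z≤n
  length≤size (x ∷ xs) = +-mono-≤ (value≥1 x) (length≤size xs)

  parts≤size : ∀ xs → All (λ x → value x ≤ size xs) xs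
  parts≤size []       = []
  parts≤size (x ∷ xs) =
    m≤m+n _ _ ∷ All.map (λ p → ≤-trans p (m≤n+m _ (value x))) (parts≤size xs)

∈-partitions⇔ : ∀ u v n xs → xs ∈ partitions u v n ⇔ IsCounted u v n xs
∈-partitions⇔ u v n xs = mk⇔ to from
  where
  to : xs ∈ partitions u v n → IsCounted u v n xs
  to p = proj₂ (∈-filter⁻ (isCounted? u v n) {xs = sequences n (partsUpTo n)}
                  (∈-deduplicate⁻ _≟ᴸ_ _ p))

  from : IsCounted u v n xs → xs ∈ partitions u v n
  from c@(_ , _ , _ , refl) =
    ∈-deduplicate⁺ _≟ᴸ_ (∈-filter⁺ (isCounted? u v n)
      (∈-sequences xs (length≤size xs) (All.map (∈-partsUpTo _) (parts≤size xs))) c)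

-- F u v n is the coefficient of aᵘ bᵛ qⁿ.  All series needed have natural
-- number coefficients.
Series : Set
Series = ℕ → ℕ → ℕ → ℕ

∑≤ : ℕ → (ℕ → ℕ) → ℕ
∑≤ n f = sum (map f (upTo (suc n)))

infixl 6 _⊕_
infixl 7 _⊗_

_⊕_ : Series → Series → Series
(F ⊕ G) u v n = F u v n + G u v n

_⊗_ : Series → Series → Series
(F ⊗ G) u v n =
  ∑≤ u λ i → ∑≤ v λ j → ∑≤ n λ k → F i j k * G (u ∸ i) (v ∸ j) (n ∸ k)

a^_b^_q^_ : ℕ → ℕ → ℕ → Series
(a^ i b^ j q^ k) u v n with (u ℕ.≟ i) ×-dec (v ℕ.≟ j) ×-dec (n ℕ.≟ k)
... | yes _ = 1
... | no _  = 0

𝟙 : Series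
𝟙 = a^ 0 b^ 0 q^ 0

partialProduct : (ℕ → Series) → ℕ → Series
partialProduct F zero    = 𝟙
partialProduct F (suc N) = partialProduct F N ⊗ F (suc N)

-- G is the infinite product of F n over n ≥ 1: every coefficient of the
-- partial products is eventually constant, with the coefficient of G as its
-- eventual value.
_IsProductOf_ : Series → (ℕ → Series) → Set
G IsProductOf F =
  ∀ u v n → ∃[ N₀ ] ∀ N → N ≥ N₀ → partialProduct F N u v n ≡ G u v n

{-# OPTIONS --safe #-}

-- Let G(a, b) be the generating function of the admissible partitions.  It is
-- enough that G(a, b) = (1 + aq) G(b, aq): applied twice this gives
-- G(a, b) = (1 + aq)(1 + bq) G(aq, bq), and iterating yields the product.
-- The functional equation comes from the partitions with bounded largest part.
-- Put m = 2k + 1, Z = 1 + aq, write a subscript ≤ x for the restriction to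
-- partitions with parts at most x, and let K count those which may follow the
-- part (m + 1)_{ab}, namely all with parts at most (m − 1)_b other than m_{a²}.
-- Writing ~ for the substitution (a, b) ↦ (b, aq), the identities
--   G_{≤ m_a} = Z K~,  G_{≤ (m+1)_{ab}} = Z (G_{≤ m_a})~,
--   G_{≤ (m+2)_{a²}} = Z (G_{≤ m_b})~
-- carry over from m to m + 2 by the recurrences in the largest part, without
-- any subtraction.  They hold in every commutative semiring; working modulo
-- qⁿ⁺¹ replaces the limit m → ∞ by an equality.

module Submission where

open import Defs
open import Algebra.Bundles using (CommutativeSemiring)
open import Algebra.Core using (Op₂)
open import Algebra.Structures.Biased using (isCommutativeSemiringˡ)
open import Data.Bool.Base using (if_then_else_)
open import Data.List.Base using (List; []; _∷_; _++_; map; filter; length; take; drop; applyUpTo)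
import Data.List.Properties as List
open import Data.List.Membership.DecPropositional _≟_ using (_∈?_)
open import Data.List.Membership.Propositional using (_∈_)
open import Data.List.Membership.Propositional.Properties
  using (∈-++⁺ˡ; ∈-++⁺ʳ; ∈-++⁻; ∈-map⁺; ∈-map⁻; ∈-filter⁺; ∈-filter⁻)
open import Data.List.Membership.Propositional.Properties.WithK using (unique∧set⇒bag)
open import Data.List.Relation.Binary.BagAndSetEquality using (∼bag⇒↭)
open import Data.List.Relation.Binary.Permutation.Propositional.Properties using (↭-length)
open import Data.List.Relation.Unary.All as All using (All; []; _∷_; all?)
import Data.List.Relation.Unary.All.Properties as All
open import Data.List.Relation.Unary.AllPairs as AllPairs using (AllPairs; []; _∷_; allPairs?)
import Data.List.Relation.Unary.AllPairs.Properties as AllPairs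
open import Data.List.Relation.Unary.Any using (here; there)
open import Data.List.Relation.Unary.Linked using (Linked; []; [-]; _∷_)
open import Data.List.Relation.Unary.Unique.Propositional using (Unique)
import Data.List.Relation.Unary.Unique.Propositional.Properties as Unique
open import Data.Nat.Base as ℕ using (ℕ; zero; suc; _∸_; _≤_; _<_; z≤n; s≤s; s≤s⁻¹)
open import Data.Nat.ListAction using (sum)
open import Data.Nat.Properties as ℕ using (≤-refl; ≤-trans; ≤-<-trans; <-≤-trans; _≤?_; _<?_)
open import Data.Parity.Base using (0ℙ; 1ℙ)
open import Data.Product.Base as Product using (_×_; _,_; proj₁; proj₂)
open import Data.Sum.Base using (inj₁; inj₂)
open import Data.Unit.Base using (⊤)
open import Function.Base using (_∘_; id)
open import Function.Bundles using (mk⇔; Equivalence)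
open import Level using (0ℓ)
open import Relation.Binary.PropositionalEquality
  using (_≡_; _≢_; refl; sym; trans; cong; cong₂; subst; subst₂; module ≡-Reasoning)
open import Relation.Binary.Structures using (IsEquivalence)
open import Relation.Nullary using (¬_; Dec; yes; no; does; ¬?; _×-dec_; recompute; contradiction)
open import Relation.Nullary.Decidable using (True; toWitness; from-yes; dec-true; dec-false)
open import Relation.Unary using (Pred; Decidable; U)
open import Relation.Unary.Properties using (U?)

-- Power series in one variable, truncated at a given degree.

module TruncatedSeries {c ℓ} (R : CommutativeSemiring c ℓ) where
  open CommutativeSemiring R hiding (zero; refl; sym; trans)
  private module R = CommutativeSemiring R
  open import Algebra.Properties.CommutativeSemigroup +-commutativeSemigroup using (interchange)
  open import Relation.Binary.Reasoning.Setoid setoid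

  ∑ : ℕ → (ℕ → Carrier) → Carrier
  ∑ zero    f = f 0
  ∑ (suc n) f = f 0 + ∑ n (f ∘ suc)

  infixl 7 _⊛_

  _⊛_ : (f g : ℕ → Carrier) → ℕ → Carrier
  (f ⊛ g) n = ∑ n λ i → f i * g (n ∸ i)

  monomial : Carrier → ℕ → ℕ → Carrier
  monomial r zero    zero    = r
  monomial r zero    (suc n) = 0#
  monomial r (suc i) zero    = 0#
  monomial r (suc i) (suc n) = monomial r i n

  monomial-cong : ∀ {r s} i n → r ≈ s → monomial r i n ≈ monomial s i n
  monomial-cong zero    zero    r≈s = r≈s
  monomial-cong zero    (suc n) r≈s = R.refl
  monomial-cong (suc i) zero    r≈s = R.refl
  monomial-cong (suc i) (suc n) r≈s = monomial-cong i n r≈s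

  monomial-same : ∀ r i → monomial r i i ≡ r
  monomial-same r zero    = refl
  monomial-same r (suc i) = monomial-same r i

  monomial-other : ∀ r {i n} → n ≢ i → monomial r i n ≡ 0#
  monomial-other r {zero}  {zero}  n≢i = contradiction refl n≢i
  monomial-other r {zero}  {suc n} n≢i = refl
  monomial-other r {suc i} {zero}  n≢i = refl
  monomial-other r {suc i} {suc n} n≢i = monomial-other r (n≢i ∘ cong suc)

  monomial-scale : ∀ r s i n → r * monomial s i n ≈ monomial (r * s) i n
  monomial-scale r s zero    zero    = R.refl
  monomial-scale r s zero    (suc n) = zeroʳ r
  monomial-scale r s (suc i) zero    = zeroʳ r
  monomial-scale r s (suc i) (suc n) = monomial-scale r s i n

  ∑-cong : ∀ n {f g} → (∀ i → i ≤ n → f i ≈ g i) → ∑ n f ≈ ∑ n g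
  ∑-cong zero    f≈g = f≈g 0 z≤n
  ∑-cong (suc n) f≈g = +-cong (f≈g 0 z≤n) (∑-cong n λ i i≤n → f≈g (suc i) (s≤s i≤n))

  ∑-+ : ∀ n f g → ∑ n (λ i → f i + g i) ≈ ∑ n f + ∑ n g
  ∑-+ zero    f g = R.refl
  ∑-+ (suc n) f g =
    R.trans (+-congˡ (∑-+ n (f ∘ suc) (g ∘ suc))) (interchange _ _ _ _)

  ⊛-cong : ∀ n {f f′ g g′} → (∀ k → k ≤ n → f k ≈ f′ k) → (∀ k → k ≤ n → g k ≈ g′ k) →
           (f ⊛ g) n ≈ (f′ ⊛ g′) n
  ⊛-cong n f≈f′ g≈g′ =
    ∑-cong n λ i i≤n → *-cong (f≈f′ i i≤n) (g≈g′ (n ∸ i) (ℕ.m∸n≤m n i))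

  ⊛-distribʳ : ∀ n f g h → ((λ k → g k + h k) ⊛ f) n ≈ (g ⊛ f) n + (h ⊛ f) n
  ⊛-distribʳ n f g h =
    R.trans (∑-cong n λ i _ → distribʳ (f (n ∸ i)) (g i) (h i)) (∑-+ n _ _)

  ⊛-scaleˡ : ∀ n r f g → ((λ k → r * f k) ⊛ g) n ≈ r * (f ⊛ g) n
  ⊛-scaleˡ zero    r f g = *-assoc _ _ _
  ⊛-scaleˡ (suc n) r f g = begin
    r * f 0 * g (suc n) + ((λ k → r * f (suc k)) ⊛ g) n
      ≈⟨ +-cong (*-assoc _ _ _) (⊛-scaleˡ n r (f ∘ suc) g) ⟩
    r * (f 0 * g (suc n)) + r * ((f ∘ suc) ⊛ g) n
      ≈⟨ distribˡ _ _ _ ⟨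
    r * (f ⊛ g) (suc n) ∎

  -- `∑` unfolds at its first term. Splitting off the last term as well is what lets commutativity
  -- go by induction.
  ⊛-sucʳ : ∀ n f g → (f ⊛ g) (suc n) ≈ (f ⊛ (g ∘ suc)) n + f (suc n) * g 0
  ⊛-sucʳ zero    f g = R.refl
  ⊛-sucʳ (suc n) f g =
    R.trans (+-congˡ (⊛-sucʳ n (f ∘ suc) g)) (R.sym (+-assoc _ _ _))

  ⊛-comm : ∀ n f g → (f ⊛ g) n ≈ (g ⊛ f) n
  ⊛-comm zero    f g = *-comm _ _
  ⊛-comm (suc n) f g = begin
    f 0 * g (suc n) + ((f ∘ suc) ⊛ g) n  ≈⟨ +-comm _ _ ⟩
    ((f ∘ suc) ⊛ g) n + f 0 * g (suc n)  ≈⟨ +-cong (⊛-comm n (f ∘ suc) g) (*-comm _ _) ⟩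
    (g ⊛ (f ∘ suc)) n + g (suc n) * f 0  ≈⟨ ⊛-sucʳ n g f ⟨
    (g ⊛ f) (suc n)                      ∎

  ⊛-assoc : ∀ n f g h → ((f ⊛ g) ⊛ h) n ≈ (f ⊛ (g ⊛ h)) n
  ⊛-assoc zero    f g h = *-assoc _ _ _
  ⊛-assoc (suc n) f g h = begin
    f 0 * g 0 * h (suc n) + ((λ k → f 0 * g (suc k) + ((f ∘ suc) ⊛ g) k) ⊛ h) n
      ≈⟨ +-cong (*-assoc _ _ _) (⊛-distribʳ n h _ _) ⟩
    f 0 * (g 0 * h (suc n)) + (((λ k → f 0 * g (suc k)) ⊛ h) n + (((f ∘ suc) ⊛ g) ⊛ h) n)
      ≈⟨ +-assoc _ _ _ ⟨
    f 0 * (g 0 * h (suc n)) + ((λ k → f 0 * g (suc k)) ⊛ h) n + (((f ∘ suc) ⊛ g) ⊛ h) n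
      ≈⟨ +-cong (+-congˡ (⊛-scaleˡ n (f 0) (g ∘ suc) h)) (⊛-assoc n (f ∘ suc) g h) ⟩
    f 0 * (g 0 * h (suc n)) + f 0 * ((g ∘ suc) ⊛ h) n + ((f ∘ suc) ⊛ (g ⊛ h)) n
      ≈⟨ +-congʳ (distribˡ _ _ _) ⟨
    (f ⊛ (g ⊛ h)) (suc n) ∎

  ⊛-zeroˡ : ∀ n f → ((λ _ → 0#) ⊛ f) n ≈ 0#
  ⊛-zeroˡ zero    f = zeroˡ _
  ⊛-zeroˡ (suc n) f = R.trans (+-cong (zeroˡ _) (⊛-zeroˡ n f)) (+-identityˡ 0#)

  monomial-⊛ : ∀ r s i j n → (monomial r i ⊛ monomial s j) n ≈ monomial (r * s) (i ℕ.+ j) n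
  monomial-⊛ r s zero    zero    zero    = R.refl
  monomial-⊛ r s zero    (suc j) zero    = zeroʳ _
  monomial-⊛ r s (suc i) j       zero    = zeroˡ _
  monomial-⊛ r s zero    zero    (suc n) =
    R.trans (+-cong (zeroʳ _) (⊛-zeroˡ n (monomial s zero))) (+-identityˡ 0#)
  monomial-⊛ r s zero    (suc j) (suc n) =
    R.trans (+-cong (monomial-scale r s j n) (⊛-zeroˡ n (monomial s (suc j)))) (+-identityʳ _)
  monomial-⊛ r s (suc i) j       (suc n) =
    R.trans (+-cong (zeroˡ _) (monomial-⊛ r s i j n)) (+-identityˡ _)

  ⊛-identityˡ : ∀ n f → (monomial 1# 0 ⊛ f) n ≈ f n
  ⊛-identityˡ zero    f = *-identityˡ _
  ⊛-identityˡ (suc n) f =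
    R.trans (+-cong (*-identityˡ _) (⊛-zeroˡ n f)) (+-identityʳ _)

  -- Two series are identified when they agree up to degree N; in other words,
  -- this is the quotient by the (N + 1)-st power of the variable.
  truncatedSeries : ℕ → CommutativeSemiring c ℓ
  truncatedSeries N = record
    { Carrier = ℕ → Carrier
    ; _≈_     = λ f g → ∀ k → k ≤ N → f k ≈ g k
    ; _+_     = λ f g k → f k + g k
    ; _*_     = _⊛_
    ; 0#      = λ _ → 0#
    ; 1#      = monomial 1# 0
    ; isCommutativeSemiring = isCommutativeSemiringˡ record
      { +-isCommutativeMonoid = record
        { isMonoid = record
          { isSemigroup = record
            { isMagma = record
              { isEquivalence = isEquivalence′
              ; ∙-cong = λ f≈f′ g≈g′ k k≤N → +-cong (f≈f′ k k≤N) (g≈g′ k k≤N)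
              }
            ; assoc = λ _ _ _ _ _ → +-assoc _ _ _
            }
          ; identity = (λ _ _ _ → +-identityˡ _) , (λ _ _ _ → +-identityʳ _)
          }
        ; comm = λ _ _ _ _ → +-comm _ _
        }
      ; *-isCommutativeMonoid = record
        { isMonoid = record
          { isSemigroup = record
            { isMagma = record
              { isEquivalence = isEquivalence′
              ; ∙-cong = λ f≈f′ g≈g′ n n≤N →
                  ⊛-cong n (λ k k≤n → f≈f′ k (≤-trans k≤n n≤N))
                           (λ k k≤n → g≈g′ k (≤-trans k≤n n≤N))
              }
            ; assoc = λ f g h n _ → ⊛-assoc n f g h
            }
          ; identity = (λ f n _ → ⊛-identityˡ n f)
                     , (λ f n _ → R.trans (⊛-comm n f _) (⊛-identityˡ n f))
          }
        ; comm = λ f g n _ → ⊛-comm n f g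
        }
      ; distribʳ = λ f g h n _ → ⊛-distribʳ n f g h
      ; zeroˡ    = λ f n _ → ⊛-zeroˡ n f
      }
    }
    where
    isEquivalence′ : IsEquivalence λ (f g : ℕ → Carrier) → ∀ k → k ≤ N → f k ≈ g k
    isEquivalence′ = record
      { refl  = λ _ _ → R.refl
      ; sym   = λ f≈g k k≤N → R.sym (f≈g k k≤N)
      ; trans = λ f≈g g≈h k k≤N → R.trans (f≈g k k≤N) (g≈h k k≤N)
      }

-- The algebraic step from m to m + 2.

-- For m = 2k + 1 and t = q²ᵏ, the letters α, β, γ, δ, ε, ζ, η, θ stand for the
-- generating functions of the partitions with parts at most m_{ab}, m_a,
-- m_{b²}, m_b, (m+1)_{ab}, (m+1)_a, (m+2)_{a²}, (m+1)_b, and K for that of the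
-- partitions that may follow (m+1)_{ab}, (m+1)_a or (m+2)_{a²}; a superscript ⁺
-- refers to m + 2.  The module is applied to the carrier of a semiring and to
-- the polynomials of the ring solver.
module Layer {c} {A : Set c} (_+_ _*_ : Op₂ A) (q x y t K β δ : A) where
  infixl 6 _⊞_
  infixl 7 _⊠_
  _⊞_ _⊠_ : Op₂ A
  _⊞_ = _+_
  _⊠_ = _*_

  T ε ζ η θ K⁺ α⁺ β⁺ γ⁺ δ⁺ : A
  T  = q ⊠ q ⊠ t
  ε  = t ⊠ (x ⊠ y ⊠ (q ⊠ q)) ⊠ K ⊞ δ
  ζ  = t ⊠ (x ⊠ (q ⊠ q)) ⊠ K ⊞ ε
  η  = t ⊠ (x ⊠ x ⊠ (q ⊠ q ⊠ q)) ⊠ K ⊞ ζ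
  θ  = t ⊠ (y ⊠ (q ⊠ q)) ⊠ β ⊞ η
  -- `η` is bypassed: among the parts up to (m+1)_b, only (m+2)_{a²} is too close to (m+3)_{ab},
  -- (m+3)_a and (m+4)_{a²}.
  K⁺ = t ⊠ (y ⊠ (q ⊠ q)) ⊠ β ⊞ ζ
  α⁺ = T ⊠ (x ⊠ y ⊠ q) ⊠ β ⊞ θ
  β⁺ = T ⊠ (x ⊠ q) ⊠ ε ⊞ α⁺
  γ⁺ = T ⊠ (y ⊠ y ⊠ q) ⊠ β ⊞ β⁺
  δ⁺ = T ⊠ (y ⊠ q) ⊠ ζ ⊞ γ⁺

module _ {c ℓ} (R : CommutativeSemiring c ℓ) where
  open CommutativeSemiring R hiding (zero; refl; sym; trans)
  private module R = CommutativeSemiring R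
  open import Algebra.Solver.Ring.NaturalCoefficients.Default R
  open import Relation.Binary.Reasoning.Setoid setoid

  module _ (q x y t K β δ K̃ β̃ δ̃ : Carrier) where
    private
      module L = Layer _+_ _*_ q x y t K β δ
      module L̃ = Layer _+_ _*_ q y (x * q) t K̃ β̃ δ̃
      module L⁺ = Layer _+_ _*_ q x y L.T L.K⁺ L.β⁺ L.δ⁺
      Z = 1# + x * q

    -- The values at m + 2 are linear in ε, η and β; replacing these by Zβ̃, Zδ̃
    -- and ZK̃ turns them into Z times the corresponding tilded value.
    module _ (β≈ : β ≈ Z * K̃) (ε≈ : L.ε ≈ Z * β̃) (η≈ : L.η ≈ Z * δ̃) where

      combination : ∀ r s u → r * L.ε + s * L.η + u * β ≈ r * (Z * β̃) + s * (Z * δ̃) + u * (Z * K̃)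
      combination r s u = +-cong (+-cong (*-congˡ ε≈) (*-congˡ η≈)) (*-congˡ β≈)

      step-β : L.β⁺ ≈ Z * L̃.K⁺
      step-β = begin
        L.β⁺
          ≈⟨ solve 7 (λ q x y t K β δ → let module P = Layer _:+_ _:*_ q x y t K β δ in
               P.β⁺ := (P.T :* x :* q) :* P.ε :+ con 1 :* P.η
                        :+ (P.T :* x :* y :* q :+ t :* y :* q :* q) :* β) R.refl q x y t K β δ ⟩
        _ ≈⟨ combination _ _ _ ⟩
        _ ≈⟨ solve 7 (λ q x y t K̃ β̃ δ̃ →
               let module P = Layer _:+_ _:*_ q y (x :* q) t K̃ β̃ δ̃
                   Z = con 1 :+ x :* q in
               (P.T :* x :* q) :* (Z :* β̃) :+ con 1 :* (Z :* δ̃)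
                  :+ (P.T :* x :* y :* q :+ t :* y :* q :* q) :* (Z :* K̃) := Z :* P.K⁺)
               R.refl q x y t K̃ β̃ δ̃ ⟩
        Z * L̃.K⁺ ∎

      -- `ζ` has to be expressed through `ε`, `η` and `β`, yet it contains `K`. The weights of
      -- (m+3)_{ab} and (m+1)_a have the same product as those of (m+2)_b and (m+2)_{a²}, so the
      -- term with `K` completes `T y q ζ` to `T y q η`.
      step-ε : L⁺.ε ≈ Z * L̃.β⁺
      step-ε = begin
        L⁺.ε
          ≈⟨ solve 7 (λ q x y t K β δ →
               let module P = Layer _:+_ _:*_ q x y t K β δ
                   module P⁺ = Layer _:+_ _:*_ q x y P.T P.K⁺ P.β⁺ P.δ⁺ in
               P⁺.ε := (P.T :* x :* y :* q :* q :+ P.T :* x :* q) :* P.ε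
                        :+ (con 1 :+ P.T :* y :* q) :* P.η
                        :+ (P.T :* y :* q :* (P.T :* x :* y :* q) :+ P.T :* x :* y :* q
                             :+ t :* y :* q :* q :+ P.T :* y :* y :* q) :* β) R.refl q x y t K β δ ⟩
        _ ≈⟨ combination _ _ _ ⟩
        _ ≈⟨ solve 7 (λ q x y t K̃ β̃ δ̃ →
               let module P = Layer _:+_ _:*_ q y (x :* q) t K̃ β̃ δ̃
                   Z = con 1 :+ x :* q in
               (P.T :* x :* y :* q :* q :+ P.T :* x :* q) :* (Z :* β̃)
                        :+ (con 1 :+ P.T :* y :* q) :* (Z :* δ̃)
                        :+ (P.T :* y :* q :* (P.T :* x :* y :* q) :+ P.T :* x :* y :* q
                             :+ t :* y :* q :* q :+ P.T :* y :* y :* q) :* (Z :* K̃) := Z :* P.β⁺)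
               R.refl q x y t K̃ β̃ δ̃ ⟩
        Z * L̃.β⁺ ∎

      -- The same exchange absorbs `K`, now between (m+4)_{a²}, (m+1)_a and (m+3)_a, (m+2)_{a²}. The
      -- summand `L⁺.ε` is covered by `step-ε`.
      step-η : L⁺.η ≈ Z * L̃.δ⁺
      step-η = begin
        L⁺.η
          ≈⟨ solve 7 (λ q x y t K β δ →
               let module P = Layer _:+_ _:*_ q x y t K β δ
                   module P⁺ = Layer _:+_ _:*_ q x y P.T P.K⁺ P.β⁺ P.δ⁺ in
               P⁺.η := P⁺.ε :+ (P.T :* (x :* x :* q :* q :* q) :* P.ε
                        :+ P.T :* (x :* q :* q) :* P.η
                        :+ P.T :* (x :* q :* q) :* (P.T :* x :* y :* q :+ t :* y :* q :* q) :* β))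
                        R.refl q x y t K β δ ⟩
        _ ≈⟨ +-cong step-ε (combination _ _ _) ⟩
        _ ≈⟨ solve 7 (λ q x y t K̃ β̃ δ̃ →
               let module P = Layer _:+_ _:*_ q y (x :* q) t K̃ β̃ δ̃
                   Z = con 1 :+ x :* q in
               Z :* P.β⁺ :+ (P.T :* (x :* x :* q :* q :* q) :* (Z :* β̃)
                        :+ P.T :* (x :* q :* q) :* (Z :* δ̃)
                        :+ P.T :* (x :* q :* q) :* (P.T :* x :* y :* q :+ t :* y :* q :* q) :* (Z :* K̃))
                 := Z :* P.δ⁺)
               R.refl q x y t K̃ β̃ δ̃ ⟩
        Z * L̃.δ⁺ ∎

-- Enumeration of the ▷-sequences with parts from a list.

infix 4 _▷?_

_▷?_ : ∀ x y → Dec (x ▷ y)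
x ▷? y = A x y ℕ.+ value y ≤? value x

-- The sequences that run through the list from left to right, with consecutive parts related by `▷`
-- and the first part, if any, satisfying `P`. Branching on whether `y` comes first is the
-- recurrence in the largest part.
below : ∀ {P : Pred ColouredInteger 0ℓ} → Decidable P →
        List ColouredInteger → List (List ColouredInteger)
below P? []       = [] ∷ []
below P? (y ∷ ys) = (if does (P? y) then map (y ∷_) (below (y ▷?_) ys) else []) ++ below P? ys

enumerate : List ColouredInteger → List (List ColouredInteger)
enumerate = below U?

module _ {P : Pred ColouredInteger 0ℓ} {P? : Decidable P} where

  below-∷ : ∀ {y} ys → P y → below P? (y ∷ ys) ≡ map (y ∷_) (below (y ▷?_) ys) ++ below P? ys
  below-∷ {y} ys Py rewrite dec-true (P? y) Py = refl

  below-all : ∀ {ys} → All P ys → below P? ys ≡ enumerate ys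
  below-all                []         = refl
  below-all {ys = _ ∷ ys} (Py ∷ Pys) = trans (below-∷ ys Py) (cong (_ ++_) (below-all Pys))

  below-none : ∀ {zs} ys → All (λ z → ¬ P z) zs → below P? (zs ++ ys) ≡ below P? ys
  below-none             ys []           = refl
  below-none {zs = z ∷ _} ys (¬Pz ∷ ¬Pzs) rewrite dec-false (P? z) ¬Pz = below-none ys ¬Pzs

Chained : Pred ColouredInteger 0ℓ → List ColouredInteger → Set
Chained P []       = ⊤
Chained P (x ∷ xs) = P x × Chained (x ▷_) xs

Chained⇒Linked : ∀ {P} xs → Chained P xs → Linked _▷_ xs
Chained⇒Linked []           _            = []
Chained⇒Linked (x ∷ [])     _            = [-]
Chained⇒Linked (x ∷ y ∷ xs) (_ , p , ps) = p ∷ Chained⇒Linked {x ▷_} (y ∷ xs) (p , ps)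

Linked-∷⇒Chained : ∀ {x xs} → Linked _▷_ (x ∷ xs) → Chained (x ▷_) xs
Linked-∷⇒Chained [-]     = _
Linked-∷⇒Chained (p ∷ l) = p , Linked-∷⇒Chained l

Linked⇒Chained : ∀ xs → Linked _▷_ xs → Chained U xs
Linked⇒Chained []      _ = _
Linked⇒Chained (_ ∷ _) l = _ , Linked-∷⇒Chained l

-- Shifts of parts by even numbers, and the rank.

raise : ColouredInteger → ColouredInteger
raise (coloured k c o) = coloured (2 ℕ.+ k) c (occurs c o)
  where
  occurs : ∀ {k} c → Occurs k c → Occurs (2 ℕ.+ k) c
  occurs a  _       = s≤s z≤n
  occurs b  _       = s≤s z≤n
  occurs ab _       = s≤s z≤n
  occurs a² (p , q) = p , ℕ.m≤n⇒m≤o+n 2 q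
  occurs b² (p , _) = p , s≤s z≤n

infixl 7 _↑_

_↑_ : ColouredInteger → ℕ → ColouredInteger
x ↑ zero  = x
x ↑ suc k = raise x ↑ k

raise-↑ : ∀ x k → raise (x ↑ k) ≡ x ↑ suc k
raise-↑ x zero    = refl
raise-↑ x (suc k) = raise-↑ (raise x) k

-- The difference table sees a value only through its parity, so adding 2 to both values leaves `A`
-- unchanged.
▷-raise : ∀ {x y} → x ▷ y → raise x ▷ raise y
▷-raise {x} {y} x▷y rewrite ℕ.+-suc (A x y) (suc (value y)) | ℕ.+-suc (A x y) (value y) = s≤s (s≤s x▷y)

▷-raise⁻ : ∀ {x y} → raise x ▷ raise y → x ▷ y
▷-raise⁻ {x} {y} p rewrite ℕ.+-suc (A x y) (suc (value y)) | ℕ.+-suc (A x y) (value y) = s≤s⁻¹ (s≤s⁻¹ p)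

▷-raiseˡ : ∀ {x y} → x ▷ y → raise x ▷ y
▷-raiseˡ x▷y = ℕ.m≤n⇒m≤o+n 2 x▷y

▷-↑ : ∀ k {x y} → x ▷ y → (x ↑ k) ▷ (y ↑ k)
▷-↑ zero    x▷y = x▷y
▷-↑ (suc k) {x} {y} x▷y = ▷-↑ k (▷-raise {x} {y} x▷y)

▷-↑⁻ : ∀ k {x y} → (x ↑ k) ▷ (y ↑ k) → x ▷ y
▷-↑⁻ zero    p = p
▷-↑⁻ (suc k) {x} {y} p = ▷-raise⁻ {x} {y} (▷-↑⁻ k p)

offset : Colour → ℕ
offset a² = 1
offset _  = 0

-- The value 3 of 3_{a²} is larger than that of its successor 2_b; with the
-- offset the rank decreases weakly along the order of the parts, and strictly
-- along ▷.
rank : ColouredInteger → ℕ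
rank x = value x ∸ offset (colour x)

colours : List Colour
colours = a ∷ b ∷ ab ∷ a² ∷ b² ∷ []

∈-colours : ∀ c → c ∈ colours
∈-colours a  = here refl
∈-colours b  = there (here refl)
∈-colours ab = there (there (here refl))
∈-colours a² = there (there (there (here refl)))
∈-colours b² = there (there (there (there (here refl))))

-- This makes `▷` lower the rank strictly: an offset of the lower part only helps, and that of the
-- upper part is beaten by every entry of its row. The 50 cases are decided by computation.
offset<minimalDifference : ∀ c p d → offset c < minimalDifference c p d
offset<minimalDifference c p d = All.lookup (All.lookup (All.lookup
  (from-yes (all? (λ c → all? (λ p → all? (λ d → offset c <? minimalDifference c p d)
    colours) (0ℙ ∷ 1ℙ ∷ [])) colours)) (∈-colours c)) (∈-parities p)) (∈-colours d)
  where
  ∈-parities : ∀ p → p ∈ 0ℙ ∷ 1ℙ ∷ []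
  ∈-parities 0ℙ = here refl
  ∈-parities 1ℙ = there (here refl)

▷⇒rank> : ∀ x y → x ▷ y → rank y < rank x
▷⇒rank> x y x▷y = ≤-<-trans (ℕ.m∸n≤m (value y) (offset (colour y))) (ℕ.m+n≤o⇒m≤o∸n (suc (value y)) (begin
  suc (value y) ℕ.+ offset (colour x)
    ≡⟨ ℕ.+-comm (suc (value y)) _ ⟩
  offset (colour x) ℕ.+ suc (value y)
    ≡⟨ ℕ.+-suc _ (value y) ⟩
  suc (offset (colour x)) ℕ.+ value y
    ≤⟨ ℕ.+-monoˡ-≤ (value y) (offset<minimalDifference (colour x) _ (colour y)) ⟩
  A x y ℕ.+ value y
    ≤⟨ x▷y ⟩
  value x ∎))
  where open ℕ.≤-Reasoning

Chained⇒rank< : ∀ y xs → Chained (y ▷_) xs → All (λ x → rank x < rank y) xs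
Chained⇒rank< y []       _          = []
Chained⇒rank< y (x ∷ xs) (y▷x , ps) =
  ▷⇒rank> y x y▷x ∷ All.map (λ z<x → ℕ.<-trans z<x (▷⇒rank> y x y▷x)) (Chained⇒rank< x xs ps)

∈-below⁻ : ∀ {P} {P? : Decidable P} ys {xs} → xs ∈ below P? ys → Chained P xs × All (_∈ ys) xs
∈-below⁻                []       (here refl) = _ , []
∈-below⁻ {P? = P?} (y ∷ ys) xs∈ with P? y
... | no _   = Product.map₂ (All.map there) (∈-below⁻ ys xs∈)
... | yes Py with ∈-++⁻ (map (y ∷_) (below (y ▷?_) ys)) xs∈
...   | inj₂ p = Product.map₂ (All.map there) (∈-below⁻ ys p)
...   | inj₁ p with ∈-map⁻ (y ∷_) p
...     | _ , q , refl with ∈-below⁻ ys q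
...       | chained , members = (Py , chained) , here refl ∷ All.map there members

-- As ▷ strictly lowers the rank, a ▷-sequence with parts in a list sorted by ≽
-- runs through that list from left to right, so below misses none.
_≽_ : ColouredInteger → ColouredInteger → Set
x ≽ y = x ≢ y × rank y ≤ rank x

∈-below⁺ : ∀ {P} {P? : Decidable P} {ys xs} → AllPairs _≽_ ys →
           Chained P xs → All (_∈ ys) xs → xs ∈ below P? ys
∈-below⁺ {ys = []}     {[]}     _ _ _ = here refl
∈-below⁺ {ys = []}     {_ ∷ _}  _ _ (() ∷ _)
∈-below⁺ {ys = y ∷ ys} {[]}     (_ ∷ s) c m = ∈-++⁺ʳ _ (∈-below⁺ s c [])
∈-below⁺ {P? = P?} {y ∷ ys} {x ∷ xs} (y≽ ∷ s) (Px , c) (x∈ ∷ xs∈) = place x∈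
  where
  -- The parts after `x` have rank below that of `x`, hence below that of `y`, so `y` is not among
  -- them.
  lower : rank x ≤ rank y → All (_∈ ys) xs
  lower x≤y = All.zipWith
    (λ { (z<x , here refl) → contradiction (<-≤-trans z<x x≤y) (ℕ.<-irrefl refl)
       ; (z<x , there z∈)  → z∈ })
    (Chained⇒rank< x xs c , xs∈)
  place : x ∈ y ∷ ys → x ∷ xs ∈ below P? (y ∷ ys)
  place (here refl) rewrite dec-true (P? x) Px =
    ∈-++⁺ˡ (∈-map⁺ (x ∷_) (∈-below⁺ s c (lower ≤-refl)))
  place (there x∈)  =
    ∈-++⁺ʳ _ (∈-below⁺ s (Px , c) (x∈ ∷ lower (proj₂ (All.lookup y≽ x∈))))

-- Sequences that begin with `y` cannot also come from `ys`, since `≽` keeps `y` out of `ys`.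
below-unique : ∀ {P} {P? : Decidable P} {ys} → AllPairs _≽_ ys → Unique (below P? ys)
below-unique {ys = []}     _        = [] ∷ []
below-unique {P? = P?} {y ∷ ys} (y≽ ∷ s) with P? y
... | no _  = below-unique s
... | yes _ = Unique.++⁺ (Unique.map⁺ List.∷-injectiveʳ (below-unique s)) (below-unique s) disjoint
  where
  disjoint : ∀ {xs} → ¬ (xs ∈ map (y ∷_) (below (y ▷?_) ys) × xs ∈ below P? ys)
  disjoint (p , q) with ∈-map⁻ (y ∷_) p
  ... | _ , _ , refl = proj₁ (All.lookup y≽ (All.head (proj₂ (∈-below⁻ ys q)))) refl

-- The permitted parts, listed block by block.

Permitted : ColouredInteger → Set
Permitted x = x ≢ 1-ab × x ≢ 1-b²

permitted? : Decidable Permitted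
permitted? x = ¬? (x ≟ 1-ab) ×-dec ¬? (x ≟ 1-b²)

1-a 1-b 2-ab 2-a 3-a² 2-b : ColouredInteger
1-a  = coloured 1 a  (s≤s z≤n)
1-b  = coloured 1 b  (s≤s z≤n)
2-ab = coloured 2 ab (s≤s z≤n)
2-a  = coloured 2 a  (s≤s z≤n)
3-a² = coloured 3 a² (refl , s≤s (s≤s (s≤s z≤n)))
2-b  = coloured 2 b  (s≤s z≤n)

-- The parts m_{ab} < … < (m+1)_b for m = 1, largest first; those for m = 2k + 1
-- are their shifts by ↑ k.
block : List ColouredInteger
block = 2-b ∷ 3-a² ∷ 2-a ∷ 2-ab ∷ 1-b ∷ 1-b² ∷ 1-a ∷ 1-ab ∷ []

-- Both excluded parts 1_{ab} and 1_{b²} lie in the lowest block, so the filter acts at shift 0 and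
-- a plain shift serves above it.
segment : ℕ → List ColouredInteger → List ColouredInteger
segment zero    xs = filter permitted? xs
segment (suc k) xs = map (_↑ suc k) xs

-- For a final segment xs of block: all permitted parts up to the one at the
-- head of xs ↑ k, largest first.
chain : ℕ → List ColouredInteger → List ColouredInteger
chain zero    xs = segment zero xs
chain (suc k) xs = segment (suc k) xs ++ chain k block

chain-++ : ∀ k xs ys → chain k (xs ++ ys) ≡ segment k xs ++ chain k ys
chain-++ zero    xs ys = List.filter-++ permitted? xs ys
chain-++ (suc k) xs ys =
  trans (cong (_++ chain k block) (List.map-++ (_↑ suc k) xs ys)) (List.++-assoc (map (_↑ suc k) xs) _ _)

segment⁺ : ∀ {p} {P : Pred ColouredInteger p} k {xs} → All (λ x → P (x ↑ k)) xs → All P (segment k xs)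
segment⁺ zero    Pxs = All.filter⁺ permitted? Pxs
segment⁺ (suc k) Pxs = All.map⁺ Pxs

-- Measured against the next block down, `x` looks like `raise x`. Raising the upper part preserves
-- `▷`, so a single comparison with `block` propagates to all lower blocks.
chain-▷ : ∀ k {x xs} → All (raise x ▷_) block → All (x ▷_) xs → All ((x ↑ k) ▷_) (chain k xs)
chain-▷ zero        p q = segment⁺ zero q
chain-▷ (suc k) {x} p q = All.++⁺ (segment⁺ (suc k) (All.map (λ {y} → ▷-↑ (suc k) {x} {y}) q))
  (chain-▷ k {raise x} (All.map (λ {y} → ▷-raiseˡ {raise x} {y}) p) p)

segment-⋫ : ∀ k {x xs} → All (λ y → ¬ x ▷ y) xs → All (λ y → ¬ (x ↑ k) ▷ y) (segment k xs)
segment-⋫ k {x} = segment⁺ k ∘ All.map (λ {y} x⋫y → x⋫y ∘ ▷-↑⁻ k {x} {y})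

rank-↑ : ∀ k x → rank (x ↑ k) ≡ k ℕ.+ k ℕ.+ rank x
rank-↑ zero    x = refl
rank-↑ (suc k) x =
  trans (rank-↑ k (raise x)) (trans (cong (k ℕ.+ k ℕ.+_) (rank-raise x)) (shuffle k (rank x)))
  where
  shuffle : ∀ k r → k ℕ.+ k ℕ.+ (2 ℕ.+ r) ≡ suc k ℕ.+ suc k ℕ.+ r
  shuffle k r = trans (ℕ.+-suc (k ℕ.+ k) (suc r))
    (cong suc (trans (ℕ.+-suc (k ℕ.+ k) r) (cong (ℕ._+ r) (sym (ℕ.+-suc k k)))))
  rank-raise : ∀ x → rank (raise x) ≡ 2 ℕ.+ rank x
  rank-raise (coloured k a  _) = refl
  rank-raise (coloured k b  _) = refl
  rank-raise (coloured k ab _) = refl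
  rank-raise (coloured (suc k) a² _) = refl
  rank-raise (coloured zero a² o) = contradiction (proj₂ (recompute (occurs? 0 a²) o)) λ ()
  rank-raise (coloured k b² _) = refl

raise-injective : ∀ {x y} → raise x ≡ raise y → x ≡ y
raise-injective refl = refl

↑-injective : ∀ k {x y} → x ↑ k ≡ y ↑ k → x ≡ y
↑-injective zero    eq = eq
↑-injective (suc k) eq = raise-injective (↑-injective k eq)

≽-↑ : ∀ k {x y} → x ≽ y → (x ↑ k) ≽ (y ↑ k)
≽-↑ k {x} {y} (x≢y , y≤x) =
  x≢y ∘ ↑-injective k ,
  subst₂ _≤_ (sym (rank-↑ k y)) (sym (rank-↑ k x)) (ℕ.+-monoʳ-≤ (k ℕ.+ k) y≤x)

block-sorted : AllPairs _≽_ block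
block-sorted = from-yes (allPairs? (λ x y → ¬? (x ≟ y) ×-dec rank y ≤? rank x) block)

-- After k shifts the ranks 1 and 2 become 2k + 1 and 2k + 2. Different blocks thus occupy disjoint
-- ranges of ranks, which is what sorts the whole chain.
block-rank : All (λ x → 1 ≤ rank x × rank x ≤ 2) block
block-rank = from-yes (all? (λ x → 1 ≤? rank x ×-dec rank x ≤? 2) block)

chain-rank : ∀ k → All (λ x → rank x < 3 ℕ.+ (k ℕ.+ k)) (chain k block)
chain-rank zero    = All.filter⁺ permitted? (All.map (s≤s ∘ proj₂) block-rank)
chain-rank (suc k) = All.++⁺
  (All.map⁺ {f = _↑ suc k} (All.map (λ {x} (_ , x≤2) → begin-strict
    rank (x ↑ suc k)           ≡⟨ rank-↑ (suc k) x ⟩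
    suc k ℕ.+ suc k ℕ.+ rank x ≤⟨ ℕ.+-monoʳ-≤ (suc k ℕ.+ suc k) x≤2 ⟩
    suc k ℕ.+ suc k ℕ.+ 2      ≡⟨ ℕ.+-comm (suc k ℕ.+ suc k) 2 ⟩
    2 ℕ.+ (suc k ℕ.+ suc k)    <⟨ ℕ.n<1+n _ ⟩
    3 ℕ.+ (suc k ℕ.+ suc k)    ∎) block-rank))
  (All.map (λ x< → <-≤-trans x< (ℕ.+-monoʳ-≤ 3 (ℕ.+-mono-≤ (ℕ.n≤1+n k) (ℕ.n≤1+n k)))) (chain-rank k))
  where open ℕ.≤-Reasoning

chain-sorted : ∀ k → AllPairs _≽_ (chain k block)
chain-sorted zero    = AllPairs.filter⁺ permitted? block-sorted
chain-sorted (suc k) = AllPairs.++⁺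
  (AllPairs.map⁺ (AllPairs.map (≽-↑ (suc k)) block-sorted))
  (chain-sorted k)
  (All.map⁺ (All.map (λ {x} (1≤x , _) → All.map (λ {y} → above {x} {y} 1≤x) (chain-rank k)) block-rank))
  where
  open ℕ.≤-Reasoning
  above : ∀ {x y} → 1 ≤ rank x → rank y < 3 ℕ.+ (k ℕ.+ k) → (x ↑ suc k) ≽ y
  above {x} {y} 1≤x y< = (λ eq → ℕ.<-irrefl (cong rank (sym eq)) y<x) , ℕ.<⇒≤ y<x
    where
    y<x : rank y < rank (x ↑ suc k)
    y<x = begin-strict
      rank y                     <⟨ y< ⟩
      3 ℕ.+ (k ℕ.+ k)            ≡⟨ cong (2 ℕ.+_) (ℕ.+-suc k k) ⟨
      1 ℕ.+ (suc k ℕ.+ suc k)    ≡⟨ ℕ.+-comm 1 (suc k ℕ.+ suc k) ⟩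
      suc k ℕ.+ suc k ℕ.+ 1      ≤⟨ ℕ.+-monoʳ-≤ (suc k ℕ.+ suc k) 1≤x ⟩
      suc k ℕ.+ suc k ℕ.+ rank x ≡⟨ rank-↑ (suc k) x ⟨
      rank (x ↑ suc k)           ∎

chain-permitted : ∀ k → All Permitted (chain k block)
chain-permitted zero    = All.all-filter permitted? block
chain-permitted (suc k) =
  All.++⁺ (All.map⁺ (All.universal (λ x → high x 1-ab ≤-refl , high x 1-b² ≤-refl) block))
          (chain-permitted k)
  where
  high : ∀ x y → value y < 2 → x ↑ suc k ≢ y
  high x y y<2 eq = ℕ.<⇒≱ y<2
    (subst (2 ≤_) (cong value (trans (raise-↑ x k) eq)) (s≤s (s≤s z≤n)))

data Raised : ColouredInteger → Set where
  raised : ∀ {x} → x ∈ block → ∀ k → Raised (x ↑ k)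

raised-value : ∀ x k → k ≤ value (x ↑ k)
raised-value x zero    = z≤n
raised-value x (suc k) rewrite sym (raise-↑ x k) = s≤s (ℕ.m≤n⇒m≤1+n (raised-value x k))

raised-raise : ∀ {x} → Raised x → Raised (raise x)
raised-raise (raised {x} x∈ k) rewrite raise-↑ x k = raised x∈ (suc k)

-- Subtracting 2 keeps the colour and the parity, so the descent ends at value 1 or 2, or at 3 for
-- the colour a², and hence in `block`.
every-raised : ∀ x → Raised x
every-raised (coloured k c o) = go k c (recompute (occurs? k c) o)
  where
  go : ∀ k c (o : Occurs k c) → Raised (coloured k c o)
  go 1 a  _ = raised {1-a}  (from-yes (1-a ∈? block)) 0
  go 1 b  _ = raised {1-b}  (from-yes (1-b ∈? block)) 0
  go 1 ab _ = raised {1-ab} (from-yes (1-ab ∈? block)) 0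
  go 1 b² _ = raised {1-b²} (from-yes (1-b² ∈? block)) 0
  go 2 a  _ = raised {2-a}  (from-yes (2-a ∈? block)) 0
  go 2 b  _ = raised {2-b}  (from-yes (2-b ∈? block)) 0
  go 2 ab _ = raised {2-ab} (from-yes (2-ab ∈? block)) 0
  go 3 a² _ = raised {3-a²} (from-yes (3-a² ∈? block)) 0
  go 1 a² (_ , s≤s ())
  go 2 a² (() , _)
  go 2 b² (() , _)
  go 4 a² (() , _)
  go (suc (suc k@(suc _))) a  _ = raised-raise (go k a  (s≤s z≤n))
  go (suc (suc k@(suc _))) b  _ = raised-raise (go k b  (s≤s z≤n))
  go (suc (suc k@(suc _))) ab _ = raised-raise (go k ab (s≤s z≤n))
  go (suc (suc k@(suc (suc (suc _))))) a² (p , _) = raised-raise (go k a² (p , s≤s (s≤s (s≤s z≤n))))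
  go (suc (suc k@(suc _))) b² (p , _) = raised-raise (go k b² (p , s≤s z≤n))

-- A `j`-fold shift has value at least `j`; this crude bound already places `x` in one of the blocks
-- 0, ..., k.
∈-chain : ∀ k x → Permitted x → value x ≤ k → x ∈ chain k block
∈-chain k x px x≤k with every-raised x
... | raised {y} y∈ j = go k (≤-trans (raised-value y j) x≤k)
  where
  go : ∀ k → j ≤ k → y ↑ j ∈ chain k block
  go zero    z≤n = ∈-filter⁺ permitted? y∈ px
  go (suc k) j≤  with ℕ.m≤n⇒m<n∨m≡n j≤
  ... | inj₁ (s≤s j≤k) = ∈-++⁺ʳ _ (go k j≤k)
  ... | inj₂ refl      = ∈-++⁺ˡ (∈-map⁺ (_↑ suc k) y∈)

-- `D` as a count over the enumeration.

HasWeights : ℕ → ℕ → ℕ → List ColouredInteger → Set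
HasWeights u v n xs = u-weight xs ≡ u × v-weight xs ≡ v × size xs ≡ n

hasWeights? : ∀ u v n → Decidable (HasWeights u v n)
hasWeights? u v n xs = (u-weight xs ℕ.≟ u) ×-dec (v-weight xs ℕ.≟ v) ×-dec (size xs ℕ.≟ n)

value≤size : ∀ xs → All (λ x → value x ≤ size xs) xs
value≤size []       = []
value≤size (x ∷ xs) =
  ℕ.m≤m+n _ _ ∷ All.map (λ p → ≤-trans p (ℕ.m≤n+m _ (value x))) (value≤size xs)

-- Two lists without repetitions and with the same members are permutations of each other. The chain
-- may stop at shift `n` because no part exceeds the size.
D-enumerate : ∀ u v n → D u v n ≡ length (filter (hasWeights? u v n) (enumerate (chain n block)))
D-enumerate u v n = ↭-length (∼bag⇒↭ (unique∧set⇒bag (partitions-unique u v n)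
  (Unique.filter⁺ (hasWeights? u v n) (below-unique (chain-sorted n)))
  (λ {xs} → mk⇔ (to xs) (from xs))))
  where
  to : ∀ xs → xs ∈ partitions u v n → xs ∈ filter (hasWeights? u v n) (enumerate (chain n block))
  to xs xs∈ with Equivalence.to (∈-partitions⇔ u v n xs) xs∈
  ... | (permitted , linked) , w@(_ , _ , refl) = ∈-filter⁺ (hasWeights? u v n)
    (∈-below⁺ (chain-sorted n) (Linked⇒Chained xs linked)
      (All.zipWith (λ {x} (p , x≤n) → ∈-chain n x p x≤n) (permitted , value≤size xs))) w
  from : ∀ xs → xs ∈ filter (hasWeights? u v n) (enumerate (chain n block)) → xs ∈ partitions u v n
  from xs xs∈ with ∈-filter⁻ (hasWeights? u v n) {xs = enumerate (chain n block)} xs∈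
  ... | xs∈′ , w with ∈-below⁻ (chain n block) xs∈′
  ...   | chained , members = Equivalence.from (∈-partitions⇔ u v n xs)
    ((All.map (All.lookup (chain-permitted n)) members , Chained⇒Linked xs chained) , w)

-- Generating functions and their recurrences in the largest part.

segment-permitted : ∀ k {xs} → All Permitted xs → segment k xs ≡ map (_↑ k) xs
segment-permitted zero    p = trans (List.filter-all permitted? p) (sym (List.map-id _))
segment-permitted (suc k) p = refl

-- raise x ▷ block makes x dominate all lower blocks too.
Splits : ColouredInteger → (us vs : List ColouredInteger) → Set
Splits x us vs = All (λ u → ¬ x ▷ u) us × All (x ▷_) vs × All (raise x ▷_) block

splits? : ∀ x us vs → Dec (Splits x us vs)
splits? x us vs =
  all? (λ u → ¬? (x ▷? u)) us ×-dec all? (x ▷?_) vs ×-dec all? (raise x ▷?_) block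

-- If the possible successors of a part form a final segment of the chain, then following that part
-- amounts to a bound on the largest part.
below-chain : ∀ k {x} us vs → Splits x us vs →
              below ((x ↑ k) ▷?_) (chain k (us ++ vs)) ≡ enumerate (chain k vs)
below-chain k {x} us vs (x⋫us , x▷vs , x▷block) = begin
  below (x ↑ k ▷?_) (chain k (us ++ vs))           ≡⟨ cong (below _) (chain-++ k us vs) ⟩
  below (x ↑ k ▷?_) (segment k us ++ chain k vs)   ≡⟨ below-none _ (segment-⋫ k {x} x⋫us) ⟩
  below (x ↑ k ▷?_) (chain k vs)                   ≡⟨ below-all (chain-▷ k x▷block x▷vs) ⟩
  enumerate (chain k vs)                           ∎
  where open ≡-Reasoning

module GeneratingFunction {c ℓ} (R : CommutativeSemiring c ℓ) (q : CommutativeSemiring.Carrier R) where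
  open CommutativeSemiring R hiding (zero; refl; sym; trans)
  private module R = CommutativeSemiring R
  open import Algebra.Properties.CommutativeSemiring.Exp R
  open import Algebra.Solver.Ring.NaturalCoefficients.Default R
    using (solve; _:+_; _:*_; _:=_; con)
  open import Relation.Binary.Reasoning.Setoid setoid

  module _ (x y : Carrier) where

    weight : ColouredInteger → Carrier
    weight z = x ^ a-exponent (colour z) * y ^ b-exponent (colour z) * q ^ value z

    product : List ColouredInteger → Carrier
    product []       = 1#
    product (z ∷ zs) = weight z * product zs

    gf : List (List ColouredInteger) → Carrier
    gf []         = 0#
    gf (zs ∷ zss) = product zs + gf zss

    gf-map-∷-++ : ∀ z xss yss → gf (map (z ∷_) xss ++ yss) ≈ weight z * gf xss + gf yss
    gf-map-∷-++ z []         yss = R.sym (R.trans (+-congʳ (zeroʳ _)) (+-identityˡ _))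
    gf-map-∷-++ z (xs ∷ xss) yss = begin
      weight z * product xs + gf (map (z ∷_) xss ++ yss)       ≈⟨ +-congˡ (gf-map-∷-++ z xss yss) ⟩
      weight z * product xs + (weight z * gf xss + gf yss)     ≈⟨ +-assoc _ _ _ ⟨
      weight z * product xs + weight z * gf xss + gf yss       ≈⟨ +-congʳ (distribˡ _ _ _) ⟨
      weight z * gf (xs ∷ xss) + gf yss                        ∎

    weight-raise : ∀ z → weight (raise z) ≈ q * q * weight z
    weight-raise z = solve 3 (λ q p r → p :* (q :* (q :* r)) := q :* q :* (p :* r)) R.refl q _ _

    weight-↑ : ∀ k z → weight (z ↑ k) ≈ (q * q) ^ k * weight z
    weight-↑ zero    z = R.sym (*-identityˡ _)
    weight-↑ (suc k) z = begin
      weight (raise z ↑ k)             ≈⟨ weight-↑ k (raise z) ⟩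
      (q * q) ^ k * weight (raise z)   ≈⟨ *-congˡ (weight-raise z) ⟩
      (q * q) ^ k * (q * q * weight z) ≈⟨ solve 3 (λ p t w → t :* (p :* w) := p :* t :* w) R.refl _ _ _ ⟩
      (q * q) ^ suc k * weight z       ∎

    F : ℕ → List ColouredInteger → Carrier
    F k xs = gf (enumerate (chain k xs))

    -- The predicate stays general to serve twice: with `U?` it gives `θ`, and in `F-suc-gap` it is
    -- the condition of following a higher part.
    gf-block : ∀ {P : ColouredInteger → Set} (P? : ∀ z → Dec (P z)) k → P (2-b ↑ k) →
               gf (below P? (chain k block)) ≈
                 (q * q) ^ k * weight 2-b * F k (drop 6 block) + gf (below P? (chain k (drop 1 block)))
    gf-block P? k p = begin
      gf (below P? (chain k block))
        ≡⟨ cong (λ s → gf (below P? s)) (chain-++ k (2-b ∷ []) (drop 1 block)) ⟩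
      gf (below P? (segment k (2-b ∷ []) ++ chain k (drop 1 block)))
        ≡⟨ cong (λ s → gf (below P? (s ++ chain k (drop 1 block))))
             (segment-permitted k (from-yes (all? permitted? (2-b ∷ [])))) ⟩
      gf (below P? (2-b ↑ k ∷ chain k (drop 1 block)))
        ≡⟨ cong gf (below-∷ {P? = P?} (chain k (drop 1 block)) p) ⟩
      gf (map (2-b ↑ k ∷_) (below (2-b ↑ k ▷?_) (chain k (drop 1 block))) ++ below P? (chain k (drop 1 block)))
        ≡⟨ cong (λ s → gf (map (2-b ↑ k ∷_) s ++ below P? (chain k (drop 1 block))))
             -- The parts 3_{a²}, 2_a, 2_{ab}, 1_b and 1_{b²} are too close to 2_b; the first that
             -- may follow it is 1_a, at the head of `drop 6 block`.
             (below-chain k (take 5 (drop 1 block)) (drop 6 block)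
               (from-yes (splits? 2-b (take 5 (drop 1 block)) (drop 6 block)))) ⟩
      gf (map (2-b ↑ k ∷_) (enumerate (chain k (drop 6 block))) ++ below P? (chain k (drop 1 block)))
        ≈⟨ gf-map-∷-++ (2-b ↑ k) (enumerate (chain k (drop 6 block))) (below P? (chain k (drop 1 block))) ⟩
      weight (2-b ↑ k) * F k (drop 6 block) + gf (below P? (chain k (drop 1 block)))
        ≈⟨ +-congʳ (*-congʳ (weight-↑ k 2-b)) ⟩
      (q * q) ^ k * weight 2-b * F k (drop 6 block) + gf (below P? (chain k (drop 1 block))) ∎

    -- No remaining part of its own block may follow `z`, and `z ↑ suc k` is by definition
    -- `raise z ↑ k`, so the tail is compared with the block below.
    F-suc : ∀ k z zs → All (λ z′ → ¬ z ▷ z′) zs →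
            F (suc k) (z ∷ zs) ≈
              (q * q) ^ suc k * weight z * gf (below (raise z ↑ k ▷?_) (chain k block)) + F (suc k) zs
    F-suc k z zs z⋫ = begin
      F (suc k) (z ∷ zs)
        ≈⟨ gf-map-∷-++ (z ↑ suc k) (below (z ↑ suc k ▷?_) (chain (suc k) zs)) (enumerate (chain (suc k) zs)) ⟩
      weight (z ↑ suc k) * gf (below (z ↑ suc k ▷?_) (chain (suc k) zs)) + F (suc k) zs
        ≈⟨ +-congʳ (*-cong (weight-↑ (suc k) z)
             (reflexive (cong gf (below-none (chain k block) (segment-⋫ (suc k) {z} z⋫))))) ⟩
      (q * q) ^ suc k * weight z * gf (below (raise z ↑ k ▷?_) (chain k block)) + F (suc k) zs ∎

    -- For parts whose successors form a final segment: `i` counts the parts at the top of the lower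
    -- block that are too close. The side conditions are decided by computation at each use.
    F-suc-all : ∀ k z zs i → {True (all? (λ z′ → ¬? (z ▷? z′)) zs)} →
                {True (splits? (raise z) (take i block) (drop i block))} →
                F (suc k) (z ∷ zs) ≈ (q * q) ^ suc k * weight z * F k (drop i block) + F (suc k) zs
    F-suc-all k z zs i {none} {splits} = begin
      F (suc k) (z ∷ zs)
        ≈⟨ F-suc k z zs (toWitness none) ⟩
      (q * q) ^ suc k * weight z * gf (below (raise z ↑ k ▷?_) (chain k block)) + F (suc k) zs
        ≡⟨ cong (λ s → (q * q) ^ suc k * weight z * gf (below (raise z ↑ k ▷?_) (chain k s)) + F (suc k) zs)
             (List.take++drop≡id i block) ⟨
      (q * q) ^ suc k * weight z * gf (below (raise z ↑ k ▷?_) (chain k (take i block ++ drop i block)))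
        + F (suc k) zs
        ≡⟨ cong (λ s → (q * q) ^ suc k * weight z * gf s + F (suc k) zs)
             (below-chain k (take i block) (drop i block) (toWitness splits)) ⟩
      (q * q) ^ suc k * weight z * F k (drop i block) + F (suc k) zs ∎

    -- For parts whose successors have a gap: in the block below, 2_b may follow while the smaller
    -- 3_{a²} may not. Splitting off 2_b first leaves a final segment, and the bracket is the
    -- recurrence for `K`.
    F-suc-gap : ∀ k z zs → {True (all? (λ z′ → ¬? (z ▷? z′)) zs)} → {True (raise z ▷? 2-b)} →
                {True (splits? (raise z) (3-a² ∷ []) (drop 2 block))} →
                F (suc k) (z ∷ zs) ≈
                  (q * q) ^ suc k * weight z *
                    ((q * q) ^ k * weight 2-b * F k (drop 6 block) + F k (drop 2 block))
                  + F (suc k) zs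
    F-suc-gap k z zs {none} {z▷2-b} {splits} = begin
      F (suc k) (z ∷ zs)
        ≈⟨ F-suc k z zs (toWitness none) ⟩
      (q * q) ^ suc k * weight z * gf (below (raise z ↑ k ▷?_) (chain k block)) + F (suc k) zs
        ≈⟨ +-congʳ (*-congˡ (gf-block (raise z ↑ k ▷?_) k (▷-↑ k {raise z} {2-b} (toWitness z▷2-b)))) ⟩
      (q * q) ^ suc k * weight z *
        ((q * q) ^ k * weight 2-b * F k (drop 6 block) + gf (below (raise z ↑ k ▷?_) (chain k (drop 1 block))))
        + F (suc k) zs
        ≡⟨ cong (λ s → (q * q) ^ suc k * weight z *
                      ((q * q) ^ k * weight 2-b * F k (drop 6 block) + gf s) + F (suc k) zs)
             (below-chain k (3-a² ∷ []) (drop 2 block) (toWitness splits)) ⟩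
      (q * q) ^ suc k * weight z *
        ((q * q) ^ k * weight 2-b * F k (drop 6 block) + F k (drop 2 block))
        + F (suc k) zs ∎

    -- For m = 1 the parts 1_{ab} and 1_{b²} are missing.
    state : ℕ → Carrier × Carrier × Carrier
    K β δ ε ζ η θ : ℕ → Carrier

    state zero    = 1# , 1# + x * q , 1# + x * q + y * q
    state (suc k) = L.K⁺ , L.β⁺ , L.δ⁺
      where module L = Layer _+_ _*_ q x y ((q * q) ^ k) (K k) (β k) (δ k)

    K k = proj₁ (state k)
    β k = proj₁ (proj₂ (state k))
    δ k = proj₂ (proj₂ (state k))
    ε k = Layer.ε _+_ _*_ q x y ((q * q) ^ k) (K k) (β k) (δ k)
    ζ k = Layer.ζ _+_ _*_ q x y ((q * q) ^ k) (K k) (β k) (δ k)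
    η k = Layer.η _+_ _*_ q x y ((q * q) ^ k) (K k) (β k) (δ k)
    θ k = Layer.θ _+_ _*_ q x y ((q * q) ^ k) (K k) (β k) (δ k)

    weights : weight 1-ab ≈ x * y * q × weight 1-a ≈ x * q ×
              weight 1-b² ≈ y * y * q × weight 1-b ≈ y * q ×
              weight 2-ab ≈ x * y * (q * q) × weight 2-a ≈ x * (q * q) ×
              weight 3-a² ≈ x * x * (q * q * q) × weight 2-b ≈ y * (q * q)
    weights =
      solve 3 (λ x y q → x :* con 1 :* (y :* con 1) :* (q :* con 1) := x :* y :* q) R.refl x y q ,
      solve 3 (λ x y q → x :* con 1 :* con 1 :* (q :* con 1) := x :* q) R.refl x y q ,
      solve 3 (λ x y q → con 1 :* (y :* (y :* con 1)) :* (q :* con 1) := y :* y :* q) R.refl x y q ,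
      solve 3 (λ x y q → con 1 :* (y :* con 1) :* (q :* con 1) := y :* q) R.refl x y q ,
      solve 3 (λ x y q → x :* con 1 :* (y :* con 1) :* (q :* (q :* con 1)) := x :* y :* (q :* q))
        R.refl x y q ,
      solve 3 (λ x y q → x :* con 1 :* con 1 :* (q :* (q :* con 1)) := x :* (q :* q)) R.refl x y q ,
      solve 3 (λ x y q → x :* (x :* con 1) :* con 1 :* (q :* (q :* (q :* con 1))) := x :* x :* (q :* q :* q))
        R.refl x y q ,
      solve 3 (λ x y q → con 1 :* (y :* con 1) :* (q :* (q :* con 1)) := y :* (q :* q)) R.refl x y q

    term-cong : ∀ {t w w′ f f′ g g′} → w ≈ w′ → f ≈ f′ → g ≈ g′ → t * w * f + g ≈ t * w′ * f′ + g′
    term-cong w≈ f≈ g≈ = +-cong (*-cong (*-congˡ w≈) f≈) g≈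

    -- A mutual induction: removing the largest part, one entry of the block after another,
    -- reproduces the formulas of `Layer`.
    F≈β : ∀ k → F k (drop 6 block) ≈ β k
    F≈δ : ∀ k → F k (drop 4 block) ≈ δ k
    F≈ε : ∀ k → F k (drop 3 block) ≈ ε k
    F≈ζ : ∀ k → F k (drop 2 block) ≈ ζ k
    F≈η : ∀ k → F k (drop 1 block) ≈ η k
    F≈θ : ∀ k → F k block ≈ θ k

    -- The two equations serve `k = 0`, where only the empty sequence may follow `z`, in agreement
    -- with the initial value 1 of `K`.
    F-gap : ∀ k z zs → chain 0 (z ∷ zs) ≡ z ∷ chain 0 zs → below (z ▷?_) (chain 0 zs) ≡ [] ∷ [] →
            {True (all? (λ z′ → ¬? (z ▷? z′)) zs)} → {True (raise z ▷? 2-b)} →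
            {True (splits? (raise z) (3-a² ∷ []) (drop 2 block))} →
            F k (z ∷ zs) ≈ (q * q) ^ k * weight z * K k + F k zs

    F≈β zero    = solve 2 (λ x q → x :* con 1 :* con 1 :* (q :* con 1) :* con 1 :+ (con 1 :+ con 0)
                             := con 1 :+ x :* q) R.refl x q
    F≈β (suc k) =
      let 1ab , 1a , _ = weights in
      R.trans (F-suc-all k 1-a (drop 7 block) 3) (term-cong 1a (F≈ε k)
      (R.trans (F-suc-all k 1-ab [] 6) (term-cong 1ab (F≈β k) (F≈θ k))))

    F≈δ zero    = solve 3 (λ x y q → con 1 :* (y :* con 1) :* (q :* con 1) :* con 1 :+
                                       (x :* con 1 :* con 1 :* (q :* con 1) :* con 1 :+ (con 1 :+ con 0))
                             := con 1 :+ x :* q :+ y :* q) R.refl x y q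
    F≈δ (suc k) =
      let _ , _ , 1b² , 1b , _ = weights in
      R.trans (F-suc-all k 1-b (drop 5 block) 2) (term-cong 1b (F≈ζ k)
      (R.trans (F-suc-all k 1-b² (drop 6 block) 6) (term-cong 1b² (F≈β k) (F≈β (suc k)))))

    F-gap zero    z zs eq below≡ = begin
      gf (enumerate (chain 0 (z ∷ zs)))
        ≡⟨ cong (λ c → gf (enumerate c)) eq ⟩
      gf (map (z ∷_) (below (z ▷?_) (chain 0 zs)) ++ enumerate (chain 0 zs))
        ≡⟨ cong (λ l → gf (map (z ∷_) l ++ enumerate (chain 0 zs))) below≡ ⟩
      weight z * 1# + F 0 zs
        ≈⟨ +-congʳ (*-congʳ (R.sym (*-identityˡ _))) ⟩
      1# * weight z * 1# + F 0 zs ∎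
    F-gap (suc k) z zs _ _ {none} {z▷2-b} {splits} =
      let _ , _ , _ , _ , _ , _ , _ , 2b = weights in
      R.trans (F-suc-gap k z zs {none} {z▷2-b} {splits})
        (term-cong R.refl (term-cong 2b (F≈β k) (F≈ζ k)) R.refl)

    F≈ε k = let _ , _ , _ , _ , 2ab , _ = weights in
      R.trans (F-gap k 2-ab (drop 4 block) refl refl) (term-cong 2ab R.refl (F≈δ k))
    F≈ζ k = let _ , _ , _ , _ , _ , 2a , _ = weights in
      R.trans (F-gap k 2-a (drop 3 block) refl refl) (term-cong 2a R.refl (F≈ε k))
    F≈η k = let _ , _ , _ , _ , _ , _ , 3a² , _ = weights in
      R.trans (F-gap k 3-a² (drop 2 block) refl refl) (term-cong 3a² R.refl (F≈ζ k))
    F≈θ k = let _ , _ , _ , _ , _ , _ , _ , 2b = weights in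
      R.trans (gf-block U? k _) (term-cong 2b (F≈β k) (F≈η k))

  -- The functional equation for bounded largest part.

  shift : ∀ k x y →
    β x y k ≈ (1# + x * q) * K y (x * q) k ×
    ε x y k ≈ (1# + x * q) * β y (x * q) k ×
    η x y k ≈ (1# + x * q) * δ y (x * q) k
  shift zero x y =
    R.sym (*-identityʳ _) ,
    -- For m = 1 the values are explicit: parts up to 2_{ab} give 1 + xq + yq + xyq², which factors.
    solve 3 (λ x y q → con 1 :* (x :* y :* (q :* q)) :* con 1 :+ (con 1 :+ x :* q :+ y :* q)
              := (con 1 :+ x :* q) :* (con 1 :+ y :* q)) R.refl x y q ,
    solve 3 (λ x y q →
      con 1 :* (x :* x :* (q :* q :* q)) :* con 1 :+ (con 1 :* (x :* (q :* q)) :* con 1 :+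
        (con 1 :* (x :* y :* (q :* q)) :* con 1 :+ (con 1 :+ x :* q :+ y :* q)))
      := (con 1 :+ x :* q) :* (con 1 :+ y :* q :+ x :* q :* q)) R.refl x y q
  shift (suc k) x y =
    let t = (q * q) ^ k
        β≈ , ε≈ , η≈ = shift k x y in
    step-β R q x y t (K x y k) (β x y k) (δ x y k)
      (K y (x * q) k) (β y (x * q) k) (δ y (x * q) k) β≈ ε≈ η≈ ,
    step-ε R q x y t (K x y k) (β x y k) (δ x y k)
      (K y (x * q) k) (β y (x * q) k) (δ y (x * q) k) β≈ ε≈ η≈ ,
    step-η R q x y t (K x y k) (β x y k) (δ x y k)
      (K y (x * q) k) (β y (x * q) k) (δ y (x * q) k) β≈ ε≈ η≈

  -- Truncation in q and the product formula.

  -- Multiplying on the right makes `scaled x (suc N)` definitionally the argument that two uses of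
  -- `Θ-shift` produce.
  scaled : Carrier → ℕ → Carrier
  scaled x zero    = x
  scaled x (suc N) = scaled x N * q

  scaled≈ : ∀ x N → scaled x N ≈ x * q ^ N
  scaled≈ x zero    = R.sym (*-identityʳ _)
  scaled≈ x (suc N) = begin
    scaled x N * q  ≈⟨ *-congʳ (scaled≈ x N) ⟩
    x * q ^ N * q   ≈⟨ solve 3 (λ x p q → x :* p :* q := x :* (q :* p)) R.refl _ _ _ ⟩
    x * q ^ suc N   ∎

  x¹y⁰q^≈scaled : ∀ x y N → x ^ 1 * y ^ 0 * q ^ N ≈ scaled x N
  x¹y⁰q^≈scaled x y N = R.trans (*-congʳ (R.trans (*-identityʳ _) (*-identityʳ x))) (R.sym (scaled≈ x N))

  x⁰y¹q^≈scaled : ∀ x y N → x ^ 0 * y ^ 1 * q ^ N ≈ scaled y N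
  x⁰y¹q^≈scaled x y N = R.trans (*-congʳ (R.trans (*-identityˡ _) (*-identityʳ y))) (R.sym (scaled≈ y N))

  x⁰y⁰q^≈q^ : ∀ x y N → x ^ 0 * y ^ 0 * q ^ N ≈ q ^ N
  x⁰y⁰q^≈q^ x y N = R.trans (*-congʳ (*-identityˡ 1#)) (*-identityˡ _)

  module Truncated (n : ℕ) (q^1+n≈0 : q ^ suc n ≈ 0#) where

    q^≈0 : ∀ {m} → n < m → q ^ m ≈ 0#
    q^≈0 {m} n<m = begin
      q ^ m                             ≡⟨ cong (q ^_) (ℕ.m+[n∸m]≡n n<m) ⟨
      q ^ (suc n ℕ.+ (m ∸ suc n))     ≈⟨ ^-homo-* q (suc n) _ ⟩
      q ^ suc n * q ^ (m ∸ suc n)     ≈⟨ *-congʳ q^1+n≈0 ⟩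
      0# * q ^ (m ∸ suc n)            ≈⟨ zeroˡ _ ⟩
      0#                                ∎

    enumerate-vanish : ∀ x y us zs → All (λ z → weight x y z ≈ 0#) us →
               gf x y (enumerate (us ++ zs)) ≈ gf x y (enumerate zs)
    enumerate-vanish x y []       zs []        = R.refl
    enumerate-vanish x y (u ∷ us) zs (u≈0 ∷ p) = begin
      gf x y (enumerate (u ∷ us ++ zs))
        ≈⟨ gf-map-∷-++ x y u (below (u ▷?_) (us ++ zs)) (enumerate (us ++ zs)) ⟩
      weight x y u * gf x y (below (u ▷?_) (us ++ zs)) + gf x y (enumerate (us ++ zs))
        ≈⟨ +-cong (R.trans (*-congʳ u≈0) (zeroˡ _)) (enumerate-vanish x y us zs p) ⟩
      0# + gf x y (enumerate zs)
        ≈⟨ +-identityˡ _ ⟩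
      gf x y (enumerate zs) ∎

    Θ : Carrier → Carrier → Carrier
    Θ x y = gf x y (enumerate (chain n block))

    -- Parts shifted `suc n` times have value above `n`, hence weight zero. All bounds inside this
    -- block therefore give the same series, so the two different bounds in `shift` disappear.
    F-suc-n : ∀ x y zs → F x y (suc n) zs ≈ Θ x y
    F-suc-n x y zs = enumerate-vanish x y (segment (suc n) zs) (chain n block)
      (segment⁺ (suc n) (All.universal
        (λ z → R.trans (*-congˡ (q^≈0 (raised-value z (suc n)))) (zeroʳ _)) zs))

    Θ-shift : ∀ x y → Θ x y ≈ (1# + x * q) * Θ y (x * q)
    Θ-shift x y = begin
      Θ x y                                    ≈⟨ F-suc-n x y (drop 3 block) ⟨
      F x y (suc n) (drop 3 block)             ≈⟨ F≈ε x y (suc n) ⟩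
      ε x y (suc n)                            ≈⟨ proj₁ (proj₂ (shift (suc n) x y)) ⟩
      (1# + x * q) * β y (x * q) (suc n)       ≈⟨ *-congˡ (F≈β y (x * q) (suc n)) ⟨
      (1# + x * q) * F y (x * q) (suc n) (drop 6 block) ≈⟨ *-congˡ (F-suc-n y (x * q) (drop 6 block)) ⟩
      (1# + x * q) * Θ y (x * q)               ∎

    Π : Carrier → Carrier → ℕ → Carrier
    Π x y zero    = 1#
    Π x y (suc N) = Π x y N * ((1# + scaled x (suc N)) * (1# + scaled y (suc N)))

    Θ-product : ∀ x y N → Θ x y ≈ Π x y N * Θ (scaled x N) (scaled y N)
    Θ-product x y zero    = R.sym (*-identityˡ _)
    Θ-product x y (suc N) = begin
      Θ x y
        ≈⟨ Θ-product x y N ⟩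
      Π x y N * Θ x′ y′
        ≈⟨ *-congˡ (R.trans (Θ-shift x′ y′) (*-congˡ (Θ-shift y′ (x′ * q)))) ⟩
      Π x y N * ((1# + x′ * q) * ((1# + y′ * q) * Θ (x′ * q) (y′ * q)))
        ≈⟨ *-congˡ (*-assoc _ _ _) ⟨
      Π x y N * ((1# + x′ * q) * (1# + y′ * q) * Θ (x′ * q) (y′ * q))
        ≈⟨ *-assoc _ _ _ ⟨
      Π x y (suc N) * Θ (x′ * q) (y′ * q) ∎
      where
      x′ = scaled x N
      y′ = scaled y N

    -- Every colour contributes a factor `x` or `y`, so only the empty partition survives.
    Θ-trivial : ∀ {x y} → x ≈ 0# → y ≈ 0# → Θ x y ≈ 1#
    Θ-trivial {x} {y} x≈0 y≈0 = begin
      gf x y (enumerate (chain n block))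
        ≡⟨ cong (λ c → gf x y (enumerate c)) (List.++-identityʳ (chain n block)) ⟨
      gf x y (enumerate (chain n block ++ []))
        ≈⟨ enumerate-vanish x y (chain n block) [] (All.universal weight≈0 _) ⟩
      1# + 0#
        ≈⟨ +-identityʳ _ ⟩
      1# ∎
      where
      left≈0 : ∀ p r s → x * p * r * s ≈ 0#
      left≈0 p r s = R.trans (*-congʳ (R.trans (*-congʳ (R.trans (*-congʳ x≈0) (zeroˡ p))) (zeroˡ r))) (zeroˡ s)
      right≈0 : ∀ p r s → p * (y * r) * s ≈ 0#
      right≈0 p r s = R.trans (*-congʳ (R.trans (*-congˡ (R.trans (*-congʳ y≈0) (zeroˡ r))) (zeroʳ p))) (zeroˡ s)
      weight≈0 : ∀ z → weight x y z ≈ 0#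
      weight≈0 (coloured k a  _) = left≈0 _ _ _
      weight≈0 (coloured k b  _) = right≈0 _ _ _
      weight≈0 (coloured k ab _) = left≈0 _ _ _
      weight≈0 (coloured k a² _) = left≈0 _ _ _
      weight≈0 (coloured k b² _) = right≈0 _ _ _

    scaled≈0 : ∀ x {N} → n < N → scaled x N ≈ 0#
    scaled≈0 x {N} n<N = R.trans (scaled≈ x N) (R.trans (*-congˡ (q^≈0 n<N)) (zeroʳ x))

    Θ≈Π : ∀ x y {N} → n < N → Θ x y ≈ Π x y N
    Θ≈Π x y {N} n<N = begin
      Θ x y                                 ≈⟨ Θ-product x y N ⟩
      Π x y N * Θ (scaled x N) (scaled y N) ≈⟨ *-congˡ (Θ-trivial (scaled≈0 x n<N) (scaled≈0 y n<N)) ⟩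
      Π x y N * 1#                          ≈⟨ *-identityʳ _ ⟩
      Π x y N                               ∎

-- Series in a, b, q as iterated truncated series.

module _ {c ℓ} (R : CommutativeSemiring c ℓ) where
  open CommutativeSemiring R using (_+_)
  open TruncatedSeries R

  ∑-apply : ∀ N n f k → TruncatedSeries.∑ (truncatedSeries N) n f k ≡ ∑ n (λ i → f i k)
  ∑-apply N zero    f k = refl
  ∑-apply N (suc n) f k = cong (_ +_) (∑-apply N n (f ∘ suc) k)

-- Nesting the three variables makes `Series` itself the carrier. Truncating at `U`, `V`, `N` still
-- retains the wanted coefficient and makes q nilpotent.
module SeriesSemiring (U V N : ℕ) where

  module ℕ[q] = TruncatedSeries ℕ.+-*-commutativeSemiring
  module ℕ[q][b] = TruncatedSeries (ℕ[q].truncatedSeries N)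
  module ℕ[q][b][a] = TruncatedSeries (ℕ[q][b].truncatedSeries V)

  seriesSemiring : CommutativeSemiring _ _
  seriesSemiring = ℕ[q][b][a].truncatedSeries U

  open CommutativeSemiring seriesSemiring
    renaming (_+_ to _⊕′_; _*_ to _⊗′_; refl to ≈-refl; sym to ≈-sym; trans to ≈-trans)
    hiding (zero)
  open import Algebra.Properties.CommutativeSemiring.Exp seriesSemiring

  private
    module Q = CommutativeSemiring (ℕ[q].truncatedSeries N)
    module B = CommutativeSemiring (ℕ[q][b].truncatedSeries V)

  mono : ℕ → ℕ → ℕ → Series
  mono i j k = ℕ[q][b][a].monomial (ℕ[q][b].monomial (ℕ[q].monomial 1 k) j) i

  mono-⊗′ : ∀ i j k i′ j′ k′ → mono i j k ⊗′ mono i′ j′ k′ ≈ mono (i ℕ.+ i′) (j ℕ.+ j′) (k ℕ.+ k′)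
  mono-⊗′ i j k i′ j′ k′ u u≤ = B.trans
    (ℕ[q][b][a].monomial-⊛ _ _ i i′ u)
    (ℕ[q][b][a].monomial-cong (i ℕ.+ i′) u λ v v≤ → Q.trans
      (ℕ[q][b].monomial-⊛ _ _ j j′ v)
      (ℕ[q][b].monomial-cong (j ℕ.+ j′) v λ n n≤ → ℕ[q].monomial-⊛ 1 1 k k′ n))

  mono-^ : ∀ i j k m → mono i j k ^ m ≈ mono (m ℕ.* i) (m ℕ.* j) (m ℕ.* k)
  mono-^ i j k zero    = ≈-refl
  mono-^ i j k (suc m) = 
    ≈-trans (*-congˡ {x = mono i j k} (mono-^ i j k m)) (mono-⊗′ i j k (m ℕ.* i) (m ℕ.* j) (m ℕ.* k))

  mono≡ : ∀ i j k u v n → mono i j k u v n ≡ (a^ i b^ j q^ k) u v n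
  mono≡ i j k u v n with u ℕ.≟ i
  ... | no u≢i   rewrite ℕ[q][b][a].monomial-other (ℕ[q][b].monomial (ℕ[q].monomial 1 k) j) u≢i = refl
  ... | yes refl rewrite ℕ[q][b][a].monomial-same (ℕ[q][b].monomial (ℕ[q].monomial 1 k) j) i
      with v ℕ.≟ j
  ...   | no v≢j   rewrite ℕ[q][b].monomial-other (ℕ[q].monomial 1 k) v≢j = refl
  ...   | yes refl rewrite ℕ[q][b].monomial-same (ℕ[q].monomial 1 k) j
        with n ℕ.≟ k
  ...     | no n≢k   rewrite ℕ[q].monomial-other 1 n≢k = refl
  ...     | yes refl rewrite ℕ[q].monomial-same 1 k = refl

  a₁ b₁ q₁ : Series
  a₁ = mono 1 0 0
  b₁ = mono 0 1 0
  q₁ = mono 0 0 1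

  a₁b₁q₁ : ∀ i j k → a₁ ^ i ⊗′ b₁ ^ j ⊗′ q₁ ^ k ≈ mono i j k
  a₁b₁q₁ i j k = ≈-trans
    (*-cong (≈-trans (*-cong (mono-^ 1 0 0 i) (mono-^ 0 1 0 j))
                     (mono-⊗′ (i ℕ.* 1) (i ℕ.* 0) (i ℕ.* 0) (j ℕ.* 0) (j ℕ.* 1) (j ℕ.* 0)))
            (mono-^ 0 0 1 k))
    (≈-trans (mono-⊗′ (i ℕ.* 1 ℕ.+ j ℕ.* 0) (i ℕ.* 0 ℕ.+ j ℕ.* 1) (i ℕ.* 0 ℕ.+ j ℕ.* 0)
                      (k ℕ.* 0) (k ℕ.* 0) (k ℕ.* 1))
      (reflexive (mono-cong i≡ j≡ k≡)))
    where
    mono-cong : ∀ {i i′ j j′ k k′} → i ≡ i′ → j ≡ j′ → k ≡ k′ → mono i j k ≡ mono i′ j′ k′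
    mono-cong refl refl refl = refl
    i≡ : i ℕ.* 1 ℕ.+ j ℕ.* 0 ℕ.+ k ℕ.* 0 ≡ i
    i≡ rewrite ℕ.*-identityʳ i | ℕ.*-zeroʳ j | ℕ.*-zeroʳ k | ℕ.+-identityʳ i | ℕ.+-identityʳ i = refl
    j≡ : i ℕ.* 0 ℕ.+ j ℕ.* 1 ℕ.+ k ℕ.* 0 ≡ j
    j≡ rewrite ℕ.*-identityʳ j | ℕ.*-zeroʳ i | ℕ.*-zeroʳ k | ℕ.+-identityʳ j = refl
    k≡ : i ℕ.* 0 ℕ.+ j ℕ.* 0 ℕ.+ k ℕ.* 1 ≡ k
    k≡ rewrite ℕ.*-identityʳ k | ℕ.*-zeroʳ i | ℕ.*-zeroʳ j = refl

  open GeneratingFunction seriesSemiring q₁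

  product≈mono : ∀ xs → product a₁ b₁ xs ≈ mono (u-weight xs) (v-weight xs) (size xs)
  product≈mono []       = ≈-refl
  product≈mono (x ∷ xs) =
    ≈-trans (*-cong (a₁b₁q₁ (a-exponent (colour x)) (b-exponent (colour x)) (value x)) (product≈mono xs))
      (mono-⊗′ (a-exponent (colour x)) (b-exponent (colour x)) (value x)
               (u-weight xs) (v-weight xs) (size xs))

  gf-coefficient : ∀ xss → gf a₁ b₁ xss U V N ≡ length (filter (hasWeights? U V N) xss)
  gf-coefficient []         = refl
  gf-coefficient (xs ∷ xss) = trans
    (cong₂ ℕ._+_
      (trans (product≈mono xs U ≤-refl V ≤-refl N ≤-refl)
             (mono≡ (u-weight xs) (v-weight xs) (size xs) U V N))
      (gf-coefficient xss))
    count
    where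
    count : (a^ u-weight xs b^ v-weight xs q^ size xs) U V N ℕ.+ length (filter (hasWeights? U V N) xss)
            ≡ length (filter (hasWeights? U V N) (xs ∷ xss))
    count with (U ℕ.≟ u-weight xs) ×-dec (V ℕ.≟ v-weight xs) ×-dec (N ℕ.≟ size xs)
    ... | yes (p , q , r) = sym (cong length (List.filter-accept (hasWeights? U V N) {xs} {xss}
                            (sym p , sym q , sym r)))
    ... | no ¬pqr = sym (cong length (List.filter-reject (hasWeights? U V N) {xs} {xss}
                      λ (p , q , r) → ¬pqr (sym p , sym q , sym r)))

  ∑≤≡∑ : ∀ n f → ∑≤ n f ≡ ℕ[q].∑ n f
  ∑≤≡∑ n f = trans (cong sum (List.map-applyUpTo id f (suc n))) (go n f)
    where
    go : ∀ n f → sum (applyUpTo f (suc n)) ≡ ℕ[q].∑ n f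
    go zero    f = ℕ.+-identityʳ (f 0)
    go (suc n) f = cong (f 0 ℕ.+_) (go n (f ∘ suc))

  -- The triple convolution agrees with the iterated one because finite sums of series are formed
  -- coefficientwise.
  ⊗≡⊗′ : ∀ F G u v n → (F ⊗ G) u v n ≡ (F ⊗′ G) u v n
  ⊗≡⊗′ F G u v n = begin
    (F ⊗ G) u v n
      ≡⟨ ∑≤≡∑ u _ ⟩
    ℕ[q].∑ u (λ i → ∑≤ v λ j → ∑≤ n λ k → F i j k ℕ.* G (u ∸ i) (v ∸ j) (n ∸ k))
      ≡⟨ ℕ[q].∑-cong u (λ i _ → trans (∑≤≡∑ v _) (ℕ[q].∑-cong v λ j _ → ∑≤≡∑ n _)) ⟩
    ℕ[q].∑ u (λ i → ℕ[q].∑ v λ j → (F i j ℕ[q].⊛ G (u ∸ i) (v ∸ j)) n)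
      ≡⟨ ℕ[q].∑-cong u (λ i _ → ∑-apply ℕ.+-*-commutativeSemiring N v _ n) ⟨
    ℕ[q].∑ u (λ i → (F i ℕ[q][b].⊛ G (u ∸ i)) v n)
      ≡⟨ ∑-apply ℕ.+-*-commutativeSemiring N u _ n ⟨
    ℕ[q][b].∑ u (λ i → (F i ℕ[q][b].⊛ G (u ∸ i)) v) n
      ≡⟨ cong (λ f → f n) (∑-apply (ℕ[q].truncatedSeries N) V u _ v) ⟨
    (F ⊗′ G) u v n ∎
    where open ≡-Reasoning

  pointwise : ∀ {F G : Series} → (∀ u v n → F u v n ≡ G u v n) → F ≈ G
  pointwise F≡G u _ v _ n _ = F≡G u v n

  q₁^1+N≈0 : q₁ ^ suc N ≈ 0#
  q₁^1+N≈0 = ≈-trans (≈-trans (≈-sym (x⁰y⁰q^≈q^ a₁ b₁ (suc N))) (a₁b₁q₁ 0 0 (suc N)))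
    λ u _ v _ n n≤N → trans (mono≡ 0 0 (suc N) u v n) (vanishes u v n n≤N)
    where
    vanishes : ∀ u v n → n ≤ N → (a^ 0 b^ 0 q^ suc N) u v n ≡ 0
    vanishes u v n n≤N with (u ℕ.≟ 0) ×-dec (v ℕ.≟ 0) ×-dec (n ℕ.≟ suc N)
    ... | yes (_ , _ , refl) = contradiction n≤N ℕ.1+n≰n
    ... | no _               = refl

  -- Coefficients of the partial products.

  open Truncated N q₁^1+N≈0

  factor : ℕ → Series
  factor n = (𝟙 ⊕ a^ 1 b^ 0 q^ n) ⊗ (𝟙 ⊕ a^ 0 b^ 1 q^ n)

  a^1q^≈scaled : ∀ n → a^ 1 b^ 0 q^ n ≈ scaled a₁ n
  a^1q^≈scaled n = ≈-trans (pointwise λ u v m → sym (mono≡ 1 0 n u v m))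
    (≈-trans (≈-sym (a₁b₁q₁ 1 0 n)) (x¹y⁰q^≈scaled a₁ b₁ n))

  b^1q^≈scaled : ∀ n → a^ 0 b^ 1 q^ n ≈ scaled b₁ n
  b^1q^≈scaled n = ≈-trans (pointwise λ u v m → sym (mono≡ 0 1 n u v m))
    (≈-trans (≈-sym (a₁b₁q₁ 0 1 n)) (x⁰y¹q^≈scaled a₁ b₁ n))

  𝟙≈1# : 𝟙 ≈ 1#
  𝟙≈1# = pointwise λ u v n → sym (mono≡ 0 0 0 u v n)

  partialProduct≈Π : ∀ M → partialProduct factor M ≈ Π a₁ b₁ M
  partialProduct≈Π zero    = 𝟙≈1#
  partialProduct≈Π (suc M) = ≈-trans (pointwise (⊗≡⊗′ (partialProduct factor M) (factor (suc M))))
    (*-cong (partialProduct≈Π M)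
      (≈-trans (pointwise (⊗≡⊗′ (𝟙 ⊕ a^ 1 b^ 0 q^ suc M) (𝟙 ⊕ a^ 0 b^ 1 q^ suc M)))
        (*-cong (+-cong 𝟙≈1# (a^1q^≈scaled (suc M))) (+-cong 𝟙≈1# (b^1q^≈scaled (suc M))))))

  coefficient : ∀ M → N < M → partialProduct factor M U V N ≡ D U V N
  coefficient M N<M = begin
    partialProduct factor M U V N
      ≡⟨ ≈-trans (partialProduct≈Π M) (≈-sym (Θ≈Π a₁ b₁ N<M)) U ≤-refl V ≤-refl N ≤-refl ⟩
    Θ a₁ b₁ U V N
      ≡⟨ gf-coefficient (enumerate (chain N block)) ⟩
    length (filter (hasWeights? U V N) (enumerate (chain N block)))
      ≡⟨ D-enumerate U V N ⟨
    D U V N ∎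
    where open ≡-Reasoning

theorem1p7 : D IsProductOf (λ n → (𝟙 ⊕ a^ 1 b^ 0 q^ n) ⊗ (𝟙 ⊕ a^ 0 b^ 1 q^ n))
-- From `suc n` on, the scaled variables vanish modulo q^(n+1), as `Θ≈Π` requires.
theorem1p7 u v n = suc n , SeriesSemiring.coefficient u v n
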